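{- For $m\ge2$, let $Q_{4m}=\langle a,b\mid a^{2m}=e,\ b^2=a^m,\ b^{ -1}ab=a^{ -1}\rangle$ be the generalized quaternion group of order $4m$. In the directed Cayley graph $\Gamma(Q_{4m},\{a,a^{ -1},b\})$ the Lin--Lu--Yau Ricci curvatures of the arcs $(e,a)$ and $(e,b)$ are $$\kappa(e,a)=\begin{cases}\tfrac23,& m=2,\\ \tfrac13,& m=3,\\ 0,& m\ge4,\end{cases}\qquad \kappa(e,b)=0\ \text{ for all } m\ge2.$$
   Context: For a group $G$ with identity $e$ and a finite set $S\subseteq G\setminus\{e\}$, the directed Cayley graph $\Gamma(G,S)$ has vertex set $G$ and arcs $(g,gs)$ for $g\in G$, $s\in S$. In a simple directed graph $(V,\mathcal A)$, $N^{\rm out}(x)=\{v\in V:(x,v)\in\mathcal A\}$, $d^{\rm out}_x=|N^{\rm out}(x)|$, and $d(x,y)$ is the length of a shortest directed path from $x$ to $y$. For $\alpha\in[0,1]$, the $\alpha$-lazy random walk measure at $x$ is $\mu^\alpha_x(x)=\alpha$, $\mu^\alpha_x(v)=\frac{1-\alpha}{d^{\rm out}_x}$ if $(x,v)\in\mathcal A$, and $\mu_x^\alpha(v)=0$ otherwise. For probability measures $\mu,\nu$ on $V$, $W(\mu,\nu)=\inf_A\sum_{u,v\in V}A(u,v)d(u,v)$, the infimum over couplings $A:V\times V\to[0,1]$ with $\sum_{v}A(u,v)=\mu(u)$ for all $u$ and $\sum_uA(u,v)=\nu(v)$ for all $v$. For distinct $x,y$, $\kappa_\alpha(x,y)=1-\frac{W(\mu_x^\alpha,\mu_y^\alpha)}{d(x,y)}$,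 and the Lin--Lu--Yau Ricci curvature is $\kappa(x,y)=\lim_{\alpha\to1^- }\frac{\kappa_\alpha(x,y)}{1-\alpha}$. -}

module Defs where

open import Level using (0ℓ; _⊔_) renaming (suc to lsuc)
open import Data.Bool.Base using (Bool; true; false)
open import Data.Empty using (⊥-elim)
open import Data.Fin.Base as Fin using (Fin; zero; suc; toℕ; fromℕ<)
import Data.Fin.Properties as Fin
open import Data.List.Base using (List; []; _∷_; length; filter; tabulate)
open import Data.List.Relation.Unary.Any as Any using (Any; here; there; any?)
import Data.List.Membership.Setoid as Membership
import Data.List.Membership.Setoid.Properties as MembershipProperties
open import Data.Nat.Base as ℕ using (ℕ; zero; suc; NonZero; z≤n; s≤s)
import Data.Nat.DivMod as ℕ
import Data.Nat.Properties as ℕ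
open import Data.Nat.Tactic.RingSolver using (solve-∀)
open import Data.Product.Base using (Σ-syntax; ∃-syntax; _×_; _,_; proj₁; proj₂)
open import Data.Sum.Base using (_⊎_; inj₁; inj₂)
open import Algebra.Apartness.Bundles using (HeytingCommutativeRing; HeytingField)
open import Algebra.Bundles using (CommutativeRing; Group)
import Algebra.Definitions.RawMonoid as RawMonoidDefs
import Algebra.Properties.Group as GroupProperties
open import Function.Base using (_∘_)
open import Function.Bundles using (Inverse)
open import Function.Properties.Inverse using (Inverse⇒Injection)
import Function.Construct.Symmetry as Symmetry
open import Relation.Binary.Bundles using (Setoid)
open import Relation.Binary.Core using (Rel)
open import Relation.Binary.Definitions using (Decidable; Irreflexive; _Respects₂_)
open import Relation.Binary.PropositionalEquality.Core as ≡ using (_≡_)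
open import Relation.Binary.PropositionalEquality.Properties as ≡ using ()
import Relation.Binary.Reasoning.Setoid as SetoidReasoning
open import Relation.Binary.Structures using (IsStrictPartialOrder)
open import Relation.Nullary.Decidable using (yes; no; via-injection)
open import Relation.Nullary.Negation using (¬_)

-- The standard library has no reals.  They are axiomatised as a
-- Cauchy-complete Archimedean ordered field.  The axioms are the
-- constructive ones (equality is tight with respect to the apartness
-- "x < y or y < x", and trichotomy is not assumed), so the real numbers
-- of constructive as well as of classical mathematics satisfy them; with
-- excluded middle they determine ℝ up to isomorphism.

record RealField c ℓ₁ ℓ₂ : Set (lsuc (c ⊔ ℓ₁ ⊔ ℓ₂)) where
  field
    heytingField : HeytingField c ℓ₁ ℓ₂

  open HeytingField heytingField public

  open HeytingCommutativeRing heytingCommutativeRing public using (commutativeRing)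
  open CommutativeRing commutativeRing public using (+-rawMonoid)
  open RawMonoidDefs +-rawMonoid public using (sum) renaming (_×_ to _·_)

  infix 4 _<_ _≤_

  field
    _<_                  : Rel Carrier ℓ₂
    isStrictPartialOrder : IsStrictPartialOrder _≈_ _<_
    #⇒<⊎>                : ∀ {x y} → x # y → x < y ⊎ y < x
    <⇒#                  : ∀ {x y} → x < y → x # y
    0<1                  : 0# < 1#
    +-monoʳ-<            : ∀ x {y z} → y < z → x + y < x + z
    *-pos                : ∀ {x y} → 0# < x → 0# < y → 0# < x * y

  _≤_ : Rel Carrier ℓ₂
  x ≤ y = ¬ (y < x)

  fromℕ : ℕ → Carrier
  fromℕ n = n · 1#

  -- ∣ x - y ∣ < ε
  Within : Carrier → Carrier → Carrier → Set ℓ₂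
  Within ε x y = x - y < ε × y - x < ε

  IsCauchy : (ℕ → Carrier) → Set (c ⊔ ℓ₂)
  IsCauchy s = ∀ ε → 0# < ε →
    ∃[ N ] (∀ i j → N ℕ.≤ i → N ℕ.≤ j → Within ε (s i) (s j))

  ConvergesTo : (ℕ → Carrier) → Carrier → Set (c ⊔ ℓ₂)
  ConvergesTo s l = ∀ ε → 0# < ε →
    ∃[ N ] (∀ i → N ℕ.≤ i → Within ε (s i) l)

  field
    archimedean : ∀ x → ∃[ n ] x < fromℕ n
    complete    : ∀ s → IsCauchy s → ∃[ l ] ConvergesTo s l

  module <-SPO = IsStrictPartialOrder isStrictPartialOrder

  -- ‘#⇒invertible’ yields an inverse of x - 0#, which is one of x.
  _⁻¹[_] : ∀ x → x # 0# → Carrier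
  x ⁻¹[ x#0 ] = proj₁ (#⇒invertible x#0)

  pos⇒#0 : ∀ {x} → 0# < x → x # 0#
  pos⇒#0 = #-sym ∘ <⇒#

  x<y⇒0<y-x : ∀ {x y} → x < y → 0# < y - x
  x<y⇒0<y-x {x} {y} x<y =
    <-SPO.<-respˡ-≈ (-‿inverseˡ x) (<-SPO.<-respʳ-≈ (+-comm (- x) y) (+-monoʳ-< (- x) x<y))

  fromℕ-pos : ∀ n → 0# < fromℕ (suc n)
  fromℕ-pos zero    = <-SPO.<-respʳ-≈ (sym (+-identityʳ 1#)) 0<1
  fromℕ-pos (suc n) = <-SPO.trans 0<1
    (<-SPO.<-respˡ-≈ (+-identityʳ 1#) (+-monoʳ-< 1# (fromℕ-pos n)))

  infixl 7 _/ℕ_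

  _/ℕ_ : Carrier → (n : ℕ) → .{{NonZero n}} → Carrier
  x /ℕ n@(suc n-1) = x * (fromℕ n ⁻¹[ pos⇒#0 (fromℕ-pos n-1) ])

  -- The infimum of the set of reals satisfying P.
  IsInfimum : ∀ {p} → (Carrier → Set p) → Carrier → Set (c ⊔ ℓ₂ ⊔ p)
  IsInfimum P w =
    (∀ z → P z → w ≤ z) × (∀ ε → 0# < ε → ∃[ z ] P z × z < w + ε)

  -- The left-hand limit at 1 of a partial function on [0,1], given by
  -- its graph F (with values indexed by a proof of α < 1) and required to
  -- be defined on [0,1) near 1.
  IsLeftLimitAt1 : ∀ {p} → (∀ α → α < 1# → Carrier → Set p) → Carrier → Set (c ⊔ ℓ₂ ⊔ p)
  IsLeftLimitAt1 F l = ∀ ε → 0# < ε → ∃[ δ ] 0# < δ ×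
    (∀ α → 0# ≤ α → 1# - δ < α → (α<1 : α < 1#) → ∃[ k ] F α α<1 k × Within ε k l)

record FiniteDigraph c ℓ r : Set (lsuc (c ⊔ ℓ ⊔ r)) where
  infix 4 _⟶_ _⟶?_
  field
    vertices    : Setoid c ℓ
    order       : ℕ
    enumeration : Inverse (≡.setoid (Fin order)) vertices

  open Setoid vertices public
    renaming (Carrier to Vertex; refl to ≈-refl; sym to ≈-sym; trans to ≈-trans)

  field
    _⟶_      : Rel Vertex r
    ⟶-resp   : _⟶_ Respects₂ _≈_
    ⟶-irrefl : Irreflexive _≈_ _⟶_
    _⟶?_     : Decidable _⟶_

  vertex : Fin order → Vertex
  vertex = Inverse.to enumeration

  infix 4 _≈?_

  _≈?_ : Decidable _≈_
  _≈?_ = via-injection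
    (Inverse⇒Injection (Symmetry.inverse enumeration)) Fin._≟_

  outNeighbours : Vertex → List Vertex
  outNeighbours x = filter (x ⟶?_) (tabulate vertex)

  outdeg : Vertex → ℕ
  outdeg x = length (outNeighbours x)

  data Walk : Vertex → Vertex → ℕ → Set (c ⊔ ℓ ⊔ r) where
    stop : ∀ {u v} → u ≈ v → Walk u v 0
    step : ∀ {u v w n} → u ⟶ v → Walk v w n → Walk u w (suc n)

  -- Quantifying over all pairs includes strong connectedness.
  record IsDistance (d : Vertex → Vertex → ℕ) : Set (c ⊔ ℓ ⊔ r) where
    field
      attained : ∀ u v → Walk u v (d u v)
      shortest : ∀ u v n → Walk u v n → d u v ℕ.≤ n

    distinct⇒nonZero : ∀ {u v} → ¬ u ≈ v → NonZero (d u v)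
    distinct⇒nonZero {u} {v} u≉v with d u v | attained u v
    ... | zero  | stop u≈v = ⊥-elim (u≉v u≈v)
    ... | suc _ | _        = _

  outdeg-nonZero : ∀ {x v} → x ⟶ v → NonZero (outdeg x)
  outdeg-nonZero {x} {v} x⟶v with outNeighbours x | v∈out
    where
    open Membership vertices using (_∈_)
    v∈vertices : v ∈ tabulate vertex
    v∈vertices = Any.map (λ eq → ≈-trans (≈-sym (Inverse.inverseˡ enumeration ≡.refl)) eq)
      (MembershipProperties.∈-tabulate⁺ vertices (Inverse.from enumeration v))
    v∈out : v ∈ outNeighbours x
    v∈out = MembershipProperties.∈-filter⁺ vertices (x ⟶?_) (proj₁ ⟶-resp) v∈vertices x⟶v
  ... | _ ∷ _ | _ = _

module Curvature {c ℓ₁ ℓ₂} (R : RealField c ℓ₁ ℓ₂)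
                 {v ℓ r} (Γ : FiniteDigraph v ℓ r) where

  private
    open module ℝ = RealField R using (0#; 1#; _+_; _-_; _*_; _≤_; _<_; _/ℕ_; _⁻¹[_])
    ℝ = ℝ.Carrier
  open FiniteDigraph Γ

  ∑ : (Vertex → ℝ) → ℝ
  ∑ f = ℝ.sum (f ∘ vertex)

  lazyWalk : ℝ → Vertex → Vertex → ℝ
  lazyWalk α x v with x ≈? v | x ⟶? v
  ... | yes _ | _       = α
  ... | no _  | yes x⟶v = ((1# - α) /ℕ outdeg x) {{outdeg-nonZero x⟶v}}
  ... | no _  | no _    = 0#

  record Coupling (μ ν : Vertex → ℝ) : Set (c ⊔ ℓ₁ ⊔ ℓ₂ ⊔ v ⊔ ℓ) where
    field
      plan      : Vertex → Vertex → ℝ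
      plan-cong : ∀ {u u′ w w′} → u ≈ u′ → w ≈ w′ → plan u w ℝ.≈ plan u′ w′
      0≤plan    : ∀ u w → 0# ≤ plan u w
      plan≤1    : ∀ u w → plan u w ≤ 1#
      marginalˡ : ∀ u → ∑ (λ w → plan u w) ℝ.≈ μ u
      marginalʳ : ∀ w → ∑ (λ u → plan u w) ℝ.≈ ν w

  module _ (d : Vertex → Vertex → ℕ) where

    cost : ∀ {μ ν} → Coupling μ ν → ℝ
    cost A = ∑ λ u → ∑ λ w → Coupling.plan A u w * ℝ.fromℕ (d u w)

    IsWasserstein : (μ ν : Vertex → ℝ) → ℝ → Set (c ⊔ ℓ₁ ⊔ ℓ₂ ⊔ v ⊔ ℓ)
    IsWasserstein μ ν = ℝ.IsInfimum (λ z → Σ[ A ∈ Coupling μ ν ] cost A ℝ.≈ z)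

  -- k = κ_α(x,y)
  IsIdleCurvature : ∀ {d} → IsDistance d → ∀ {x y} → ¬ x ≈ y → ℝ → ℝ →
                    Set (c ⊔ ℓ₁ ⊔ ℓ₂ ⊔ v ⊔ ℓ)
  IsIdleCurvature {d} isDistance {x} {y} x≉y α k =
    ∃[ w ] IsWasserstein d (lazyWalk α x) (lazyWalk α y) w
         × k ℝ.≈ 1# - (w /ℕ d x y) {{IsDistance.distinct⇒nonZero isDistance x≉y}}

  -- κ(x,y) is defined and equal to κ.  The distance function is unique,
  -- so including it existentially asserts only that distances are finite.
  record HasRicciCurvature (x y : Vertex) (κ : ℝ) : Set (c ⊔ ℓ₁ ⊔ ℓ₂ ⊔ v ⊔ ℓ ⊔ r) where
    field
      distinct   : ¬ x ≈ y
      dist       : Vertex → Vertex → ℕ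
      isDistance : IsDistance dist
      limit      : ℝ.IsLeftLimitAt1
        (λ α α<1 q → ∃[ k ] IsIdleCurvature isDistance distinct α k
          × q ℝ.≈ k * ((1# - α) ⁻¹[ ℝ.pos⇒#0 (ℝ.x<y⇒0<y-x α<1) ]))
        κ

module _ {c ℓ} (G : Group c ℓ) where
  open Group G
  open Membership setoid using (_∈_)

  Cayley : ∀ {n} → Inverse (≡.setoid (Fin n)) setoid →
           (S : List Carrier) → ¬ ε ∈ S → FiniteDigraph c ℓ (c ⊔ ℓ)
  Cayley enum S ε∉S = record
    { vertices    = setoid
    ; enumeration = enum
    ; _⟶_         = λ g h → Any (λ s → h ≈ g ∙ s) S
    ; ⟶-resp      = (λ h≈h′ → Any.map (trans (sym h≈h′)))
                  , (λ g≈g′ → Any.map (λ eq → trans eq (∙-congʳ g≈g′)))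
    ; ⟶-irrefl    = λ {g} g≈h → ε∉S ∘ Any.map (λ {s} eq →
                      sym (identityʳ-unique g s (trans (sym eq) (sym g≈h))))
    ; _⟶?_        = λ g h → any? (λ s → h ≟ g ∙ s) S
    }
    where
    open GroupProperties G using (identityʳ-unique)
    infix 4 _≟_
    _≟_ : Decidable _≈_
    _≟_ = via-injection (Inverse⇒Injection (Symmetry.inverse enum)) Fin._≟_

infixl 7 _∙_
infix  8 _⁻¹
infixr 8 _^_

data Word (X : Set) : Set where
  gen : X → Word X
  ε   : Word X
  _∙_ : Word X → Word X → Word X
  _⁻¹ : Word X → Word X

_^_ : ∀ {X} → Word X → ℕ → Word X
w ^ zero  = ε
w ^ suc n = w ∙ w ^ n

module Presentation {X : Set} (Relation : Rel (Word X) 0ℓ) where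

  infix 4 _≈_

  -- The least congruence that contains the relations and makes words
  -- into a group.
  data _≈_ : Rel (Word X) 0ℓ where
    relation  : ∀ {u v} → Relation u v → u ≈ v
    refl      : ∀ {u} → u ≈ u
    sym       : ∀ {u v} → u ≈ v → v ≈ u
    trans     : ∀ {u v w} → u ≈ v → v ≈ w → u ≈ w
    ∙-cong    : ∀ {u u′ v v′} → u ≈ u′ → v ≈ v′ → u ∙ v ≈ u′ ∙ v′
    ⁻¹-cong   : ∀ {u v} → u ≈ v → u ⁻¹ ≈ v ⁻¹
    assoc     : ∀ u v w → (u ∙ v) ∙ w ≈ u ∙ (v ∙ w)
    identityˡ : ∀ u → ε ∙ u ≈ u
    identityʳ : ∀ u → u ∙ ε ≈ u
    inverseˡ  : ∀ u → u ⁻¹ ∙ u ≈ ε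
    inverseʳ  : ∀ u → u ∙ u ⁻¹ ≈ ε

  group : Group 0ℓ 0ℓ
  group = record
    { Carrier = Word X
    ; _≈_     = _≈_
    ; _∙_     = _∙_
    ; ε       = ε
    ; _⁻¹     = _⁻¹
    ; isGroup = record
      { isMonoid = record
        { isSemigroup = record
          { isMagma = record
            { isEquivalence = record { refl = refl ; sym = sym ; trans = trans }
            ; ∙-cong        = ∙-cong
            }
          ; assoc = assoc
          }
        ; identity = identityˡ , identityʳ
        }
      ; inverse = inverseˡ , inverseʳ
      ; ⁻¹-cong = ⁻¹-cong
      }
    }

data Generator : Set where
  a′ b′ : Generator

a b : Word Generator
a = gen a′
b = gen b′

data QuaternionRelation (m : ℕ) : Rel (Word Generator) 0ℓ where
  a²ᵐ≈ε     : QuaternionRelation m (a ^ (2 ℕ.* m)) ε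
  b²≈aᵐ     : QuaternionRelation m (b ^ 2) (a ^ m)
  b⁻¹ab≈a⁻¹ : QuaternionRelation m (b ⁻¹ ∙ a ∙ b) (a ⁻¹)

Q : ℕ → Group 0ℓ 0ℓ
Q m = Presentation.group (QuaternionRelation m)

-- The order of Q m is 4m: every word equals some aⁱbʲ with i < 2m and
-- j < 2, and these are distinguished by the right multiplication action
-- on the exponents (i , j), where i is taken modulo 2m.

module NormalForm (k : ℕ) where

  private
    m N : ℕ
    m = suc k
    N = 2 ℕ.* m

  open Presentation (QuaternionRelation m)
  open Group (Q m) using (setoid; ∙-congˡ; ∙-congʳ)
  open SetoidReasoning setoid

  State : Set
  State = ℕ × Bool

  _≋_ : Rel ℕ 0ℓ
  i ≋ j = i ℕ.% N ≡ j ℕ.% N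

  data _∼_ : Rel State 0ℓ where
    _,_ : ∀ {i j} → i ≋ j → ∀ s → (i , s) ∼ (j , s)

  ∼-refl : ∀ {x} → x ∼ x
  ∼-refl {i , s} = ≡.refl , s

  ∼-sym : ∀ {x y} → x ∼ y → y ∼ x
  ∼-sym (p , s) = ≡.sym p , s

  ∼-trans : ∀ {x y z} → x ∼ y → y ∼ z → x ∼ z
  ∼-trans (p , s) (q , .s) = ≡.trans p q , s

  ≡⇒∼ : ∀ {i j s} → i ≡ j → (i , s) ∼ (j , s)
  ≡⇒∼ ≡.refl = ∼-refl

  shift-≋ : ∀ c {i j} → i ≋ j → (c ℕ.+ i) ≋ (c ℕ.+ j)
  shift-≋ c {i} {j} p = ≡.trans (ℕ.%-distribˡ-+ c i N)
    (≡.trans (≡.cong (λ t → (c ℕ.% N ℕ.+ t) ℕ.% N) p) (≡.sym (ℕ.%-distribˡ-+ c j N)))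

  wrap : ∀ {i j} q → i ≡ j ℕ.+ q ℕ.* N → i ≋ j
  wrap {j = j} q ≡.refl = ℕ.[m+kn]%n≡m%n j q N

  act act⁻ : Word Generator → State → State

  act (gen a′) (i , false) = suc i , false
  act (gen a′) (i , true)  = ℕ.pred N ℕ.+ i , true
  act (gen b′) (i , false) = i , true
  act (gen b′) (i , true)  = m ℕ.+ i , false
  act ε        x           = x
  act (u ∙ v)  x           = act v (act u x)
  act (u ⁻¹)   x           = act⁻ u x

  act⁻ (gen a′) (i , false) = ℕ.pred N ℕ.+ i , false
  act⁻ (gen a′) (i , true)  = suc i , true
  act⁻ (gen b′) (i , false) = m ℕ.+ i , true
  act⁻ (gen b′) (i , true)  = i , false
  act⁻ ε        x           = x
  act⁻ (u ∙ v)  x           = act⁻ u (act⁻ v x)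
  act⁻ (u ⁻¹)   x           = act u x

  act-cong  : ∀ w {x y} → x ∼ y → act w x ∼ act w y
  act⁻-cong : ∀ w {x y} → x ∼ y → act⁻ w x ∼ act⁻ w y

  act-cong (gen a′) (p , false) = shift-≋ 1 p , false
  act-cong (gen a′) (p , true)  = shift-≋ (ℕ.pred N) p , true
  act-cong (gen b′) (p , false) = p , true
  act-cong (gen b′) (p , true)  = shift-≋ m p , false
  act-cong ε        p           = p
  act-cong (u ∙ v)  p           = act-cong v (act-cong u p)
  act-cong (u ⁻¹)   p           = act⁻-cong u p

  act⁻-cong (gen a′) (p , false) = shift-≋ (ℕ.pred N) p , false
  act⁻-cong (gen a′) (p , true)  = shift-≋ 1 p , true
  act⁻-cong (gen b′) (p , false) = shift-≋ m p , true
  act⁻-cong (gen b′) (p , true)  = p , false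
  act⁻-cong ε        p           = p
  act⁻-cong (u ∙ v)  p           = act⁻-cong u (act⁻-cong v p)
  act⁻-cong (u ⁻¹)   p           = act-cong u p

  pred-suc : ∀ i → (ℕ.pred N ℕ.+ suc i) ≋ i
  pred-suc i = wrap 1 (eq k i)
    where
    eq : ∀ k i → (k ℕ.+ suc (k ℕ.+ 0)) ℕ.+ suc i ≡ i ℕ.+ 1 ℕ.* (2 ℕ.* suc k)
    eq = solve-∀

  suc-pred : ∀ i → suc (ℕ.pred N ℕ.+ i) ≋ i
  suc-pred i = ≡.trans (≡.cong (ℕ._% N) (≡.sym (ℕ.+-suc (ℕ.pred N) i))) (pred-suc i)

  m+m : ∀ i → (m ℕ.+ (m ℕ.+ i)) ≋ i
  m+m i = wrap 1 (eq m i)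
    where
    eq : ∀ m i → m ℕ.+ (m ℕ.+ i) ≡ i ℕ.+ 1 ℕ.* (2 ℕ.* m)
    eq = solve-∀

  act⁻∘act : ∀ w x → act⁻ w (act w x) ∼ x
  act∘act⁻ : ∀ w x → act w (act⁻ w x) ∼ x

  act⁻∘act (gen a′) (i , false) = pred-suc i , false
  act⁻∘act (gen a′) (i , true)  = suc-pred i , true
  act⁻∘act (gen b′) (i , false) = ∼-refl
  act⁻∘act (gen b′) (i , true)  = m+m i , true
  act⁻∘act ε        x           = ∼-refl
  act⁻∘act (u ∙ v)  x           =
    ∼-trans (act⁻-cong u (act⁻∘act v (act u x))) (act⁻∘act u x)
  act⁻∘act (u ⁻¹)   x           = act∘act⁻ u x

  act∘act⁻ (gen a′) (i , false) = suc-pred i , false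
  act∘act⁻ (gen a′) (i , true)  = pred-suc i , true
  act∘act⁻ (gen b′) (i , false) = m+m i , false
  act∘act⁻ (gen b′) (i , true)  = ∼-refl
  act∘act⁻ ε        x           = ∼-refl
  act∘act⁻ (u ∙ v)  x           =
    ∼-trans (act-cong v (act∘act⁻ u (act⁻ v x))) (act∘act⁻ v x)
  act∘act⁻ (u ⁻¹)   x           = act⁻∘act u x

  act-aⁿ-false : ∀ n i → act (a ^ n) (i , false) ∼ (n ℕ.+ i , false)
  act-aⁿ-false zero    i = ∼-refl
  act-aⁿ-false (suc n) i =
    ∼-trans (act-aⁿ-false n (suc i)) (≡⇒∼ (ℕ.+-suc n i))

  act-aⁿ-true : ∀ n i → act (a ^ n) (i , true) ∼ (n ℕ.* ℕ.pred N ℕ.+ i , true)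
  act-aⁿ-true zero    i = ∼-refl
  act-aⁿ-true (suc n) i =
    ∼-trans (act-aⁿ-true n (ℕ.pred N ℕ.+ i)) (≡⇒∼ (eq n (ℕ.pred N) i))
    where
    eq : ∀ n p i → n ℕ.* p ℕ.+ (p ℕ.+ i) ≡ (p ℕ.+ n ℕ.* p) ℕ.+ i
    eq = solve-∀

  act-relation : ∀ {u v} → QuaternionRelation m u v → ∀ x → act u x ∼ act v x
  act-relation a²ᵐ≈ε (i , false) =
    ∼-trans (act-aⁿ-false N i) (wrap 1 (eq N i) , false)
    where
    eq : ∀ N i → N ℕ.+ i ≡ i ℕ.+ 1 ℕ.* N
    eq = solve-∀
  act-relation a²ᵐ≈ε (i , true)  =
    ∼-trans (act-aⁿ-true N i) (wrap (ℕ.pred N) (eq N (ℕ.pred N) i) , true)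
    where
    eq : ∀ N p i → N ℕ.* p ℕ.+ i ≡ i ℕ.+ p ℕ.* N
    eq = solve-∀
  act-relation b²≈aᵐ (i , false) = ∼-sym (act-aⁿ-false m i)
  act-relation b²≈aᵐ (i , true)  =
    ∼-sym (∼-trans (act-aⁿ-true m i) (wrap k (eq k i) , true))
    where
    eq : ∀ k i → suc k ℕ.* (k ℕ.+ suc (k ℕ.+ 0)) ℕ.+ i ≡ (suc k ℕ.+ i) ℕ.+ k ℕ.* (2 ℕ.* suc k)
    eq = solve-∀
  act-relation b⁻¹ab≈a⁻¹ (i , false) = wrap 1 (eq m (ℕ.pred N) i) , false
    where
    eq : ∀ m p i → m ℕ.+ (p ℕ.+ (m ℕ.+ i)) ≡ (p ℕ.+ i) ℕ.+ 1 ℕ.* (2 ℕ.* m)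
    eq = solve-∀
  act-relation b⁻¹ab≈a⁻¹ (i , true)  = ∼-refl

  act-≈ : ∀ {u v} → u ≈ v → ∀ x → act u x ∼ act v x
  act-≈ (relation p)                x = act-relation p x
  act-≈ refl                        x = ∼-refl
  act-≈ (sym p)                     x = ∼-sym (act-≈ p x)
  act-≈ (trans p q)                 x = ∼-trans (act-≈ p x) (act-≈ q x)
  act-≈ (∙-cong {u} {u′} {v} {v′} p q) x =
    ∼-trans (act-cong v (act-≈ p x)) (act-≈ q (act u′ x))
  act-≈ (⁻¹-cong {u} {v} p)         x =
    ∼-trans (act⁻-cong u (∼-sym (act∘act⁻ v x)))
      (∼-trans (act⁻-cong u (∼-sym (act-≈ p (act⁻ v x)))) (act⁻∘act u (act⁻ v x)))
  act-≈ (assoc u v w)               x = ∼-refl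
  act-≈ (identityˡ u)               x = ∼-refl
  act-≈ (identityʳ u)               x = ∼-refl
  act-≈ (inverseˡ u)                x = act∘act⁻ u x
  act-≈ (inverseʳ u)                x = act⁻∘act u x

  word : State → Word Generator
  word (i , false) = a ^ i
  word (i , true)  = a ^ i ∙ b

  ^-+ : ∀ w i j → w ^ (i ℕ.+ j) ≈ w ^ i ∙ w ^ j
  ^-+ w zero    j = sym (identityˡ _)
  ^-+ w (suc i) j = trans (∙-congˡ (^-+ w i j)) (sym (assoc _ _ _))

  ^-sucʳ : ∀ w i → w ^ suc i ≈ w ^ i ∙ w
  ^-sucʳ w i = begin
    w ^ suc i       ≡⟨ ≡.cong (w ^_) (ℕ.+-comm 1 i) ⟩
    w ^ (i ℕ.+ 1)   ≈⟨ ^-+ w i 1 ⟩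
    w ^ i ∙ (w ∙ ε) ≈⟨ ∙-congˡ (identityʳ w) ⟩
    w ^ i ∙ w       ∎

  aᵠᴺ≈ε : ∀ q → a ^ (q ℕ.* N) ≈ ε
  aᵠᴺ≈ε zero    = refl
  aᵠᴺ≈ε (suc q) = begin
    a ^ (N ℕ.+ q ℕ.* N)     ≈⟨ ^-+ a N (q ℕ.* N) ⟩
    a ^ N ∙ a ^ (q ℕ.* N)   ≈⟨ ∙-cong (relation a²ᵐ≈ε) (aᵠᴺ≈ε q) ⟩
    ε ∙ ε                   ≈⟨ identityˡ ε ⟩
    ε                       ∎

  a^% : ∀ i → a ^ i ≈ a ^ (i ℕ.% N)
  a^% i = begin
    a ^ i                                      ≡⟨ ≡.cong (a ^_) (ℕ.m≡m%n+[m/n]*n i N) ⟩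
    a ^ (i ℕ.% N ℕ.+ i ℕ./ N ℕ.* N)            ≈⟨ ^-+ a (i ℕ.% N) _ ⟩
    a ^ (i ℕ.% N) ∙ a ^ (i ℕ./ N ℕ.* N)        ≈⟨ ∙-congˡ (aᵠᴺ≈ε (i ℕ./ N)) ⟩
    a ^ (i ℕ.% N) ∙ ε                          ≈⟨ identityʳ _ ⟩
    a ^ (i ℕ.% N)                              ∎

  a^-cong : ∀ {i j} → i ≋ j → a ^ i ≈ a ^ j
  a^-cong {i} {j} p = begin
    a ^ i         ≈⟨ a^% i ⟩
    a ^ (i ℕ.% N) ≡⟨ ≡.cong (a ^_) p ⟩
    a ^ (j ℕ.% N) ≈⟨ a^% j ⟨
    a ^ j         ∎

  word-cong : ∀ {x y} → x ∼ y → word x ≈ word y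
  word-cong (p , false) = a^-cong p
  word-cong (p , true)  = ∙-congʳ (a^-cong p)

  aᴺ⁻¹ba≈b : a ^ ℕ.pred N ∙ b ≈ b ∙ a
  aᴺ⁻¹ba≈b = sym (begin
    b ∙ a                                 ≈⟨ identityˡ (b ∙ a) ⟨
    ε ∙ (b ∙ a)                           ≈⟨ ∙-congʳ (relation a²ᵐ≈ε) ⟨
    a ^ suc (ℕ.pred N) ∙ (b ∙ a)          ≈⟨ ∙-congʳ (^-sucʳ a (ℕ.pred N)) ⟩
    (a ^ ℕ.pred N ∙ a) ∙ (b ∙ a)          ≈⟨ assoc _ _ _ ⟩
    a ^ ℕ.pred N ∙ (a ∙ (b ∙ a))          ≈⟨ ∙-congˡ aba≈b ⟩
    a ^ ℕ.pred N ∙ b                      ∎)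
    where
    aba≈b : a ∙ (b ∙ a) ≈ b
    aba≈b = begin
      a ∙ (b ∙ a)                     ≈⟨ assoc a b a ⟨
      (a ∙ b) ∙ a                     ≈⟨ ∙-congʳ (identityˡ (a ∙ b)) ⟨
      (ε ∙ (a ∙ b)) ∙ a               ≈⟨ ∙-congʳ (∙-congʳ (inverseʳ b)) ⟨
      (b ∙ b ⁻¹ ∙ (a ∙ b)) ∙ a        ≈⟨ ∙-congʳ (assoc b (b ⁻¹) (a ∙ b)) ⟩
      (b ∙ (b ⁻¹ ∙ (a ∙ b))) ∙ a      ≈⟨ ∙-congʳ (∙-congˡ (assoc (b ⁻¹) a b)) ⟨
      (b ∙ (b ⁻¹ ∙ a ∙ b)) ∙ a        ≈⟨ ∙-congʳ (∙-congˡ (relation b⁻¹ab≈a⁻¹)) ⟩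
      (b ∙ a ⁻¹) ∙ a                  ≈⟨ assoc b (a ⁻¹) a ⟩
      b ∙ (a ⁻¹ ∙ a)                  ≈⟨ ∙-congˡ (inverseˡ a) ⟩
      b ∙ ε                           ≈⟨ identityʳ b ⟩
      b                               ∎

  word-act  : ∀ w x → word (act w x) ≈ word x ∙ w
  word-act⁻ : ∀ w x → word (act⁻ w x) ≈ word x ∙ w ⁻¹

  word-act (gen a′) (i , false) = ^-sucʳ a i
  word-act (gen a′) (i , true)  = begin
    a ^ (ℕ.pred N ℕ.+ i) ∙ b     ≡⟨ ≡.cong (λ t → a ^ t ∙ b) (ℕ.+-comm (ℕ.pred N) i) ⟩
    a ^ (i ℕ.+ ℕ.pred N) ∙ b     ≈⟨ ∙-congʳ (^-+ a i (ℕ.pred N)) ⟩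
    (a ^ i ∙ a ^ ℕ.pred N) ∙ b   ≈⟨ assoc _ _ _ ⟩
    a ^ i ∙ (a ^ ℕ.pred N ∙ b)   ≈⟨ ∙-congˡ aᴺ⁻¹ba≈b ⟩
    a ^ i ∙ (b ∙ a)              ≈⟨ assoc _ _ _ ⟨
    (a ^ i ∙ b) ∙ a              ∎
  word-act (gen b′) (i , false) = refl
  word-act (gen b′) (i , true)  = begin
    a ^ (m ℕ.+ i)          ≡⟨ ≡.cong (a ^_) (ℕ.+-comm m i) ⟩
    a ^ (i ℕ.+ m)          ≈⟨ ^-+ a i m ⟩
    a ^ i ∙ a ^ m          ≈⟨ ∙-congˡ (relation b²≈aᵐ) ⟨
    a ^ i ∙ (b ∙ (b ∙ ε))  ≈⟨ ∙-congˡ (∙-congˡ (identityʳ b)) ⟩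
    a ^ i ∙ (b ∙ b)        ≈⟨ assoc _ _ _ ⟨
    (a ^ i ∙ b) ∙ b        ∎
  word-act ε        x = sym (identityʳ (word x))
  word-act (u ∙ v)  x = begin
    word (act v (act u x)) ≈⟨ word-act v (act u x) ⟩
    word (act u x) ∙ v     ≈⟨ ∙-congʳ (word-act u x) ⟩
    (word x ∙ u) ∙ v       ≈⟨ assoc _ _ _ ⟩
    word x ∙ (u ∙ v)       ∎
  word-act (u ⁻¹)   x = word-act⁻ u x

  word-act⁻ w x = begin
    word (act⁻ w x)                   ≈⟨ identityʳ _ ⟨
    word (act⁻ w x) ∙ ε               ≈⟨ ∙-congˡ (inverseʳ w) ⟨
    word (act⁻ w x) ∙ (w ∙ w ⁻¹)      ≈⟨ assoc _ _ _ ⟨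
    (word (act⁻ w x) ∙ w) ∙ w ⁻¹      ≈⟨ ∙-congʳ (word-act w (act⁻ w x)) ⟨
    word (act w (act⁻ w x)) ∙ w ⁻¹    ≈⟨ ∙-congʳ (word-cong (act∘act⁻ w x)) ⟩
    word x ∙ w ⁻¹                     ∎

  flag : Fin 2 → Bool
  flag zero       = false
  flag (suc zero) = true

  unflag : Bool → Fin 2
  unflag false = zero
  unflag true  = suc zero

  flag-unflag : ∀ s → flag (unflag s) ≡ s
  flag-unflag false = ≡.refl
  flag-unflag true  = ≡.refl

  unflag-flag : ∀ j → unflag (flag j) ≡ j
  unflag-flag zero       = ≡.refl
  unflag-flag (suc zero) = ≡.refl

  reduced : Fin N × Fin 2 → State
  reduced (i , j) = toℕ i , flag j

  decode : Fin (N ℕ.* 2) → State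
  decode t = reduced (Fin.remQuot {N} 2 t)

  encode : State → Fin (N ℕ.* 2)
  encode (i , s) = Fin.combine (fromℕ< (ℕ.m%n<n i N)) (unflag s)

  encode-cong : ∀ {x y} → x ∼ y → encode x ≡ encode y
  encode-cong (p , s) = ≡.cong (λ i → Fin.combine i (unflag s)) (Fin.fromℕ<-cong _ _ p _ _)

  encode-decode : ∀ t → encode (decode t) ≡ t
  encode-decode t = ≡.trans
    (≡.cong₂ Fin.combine
      (Fin.toℕ-injective (≡.trans (Fin.toℕ-fromℕ< _) (ℕ.m<n⇒m%n≡m (Fin.toℕ<n (proj₁ (Fin.remQuot {N} 2 t))))))
      (unflag-flag (proj₂ (Fin.remQuot {N} 2 t))))
    (Fin.combine-remQuot {N} 2 t)

  decode-encode : ∀ x → decode (encode x) ∼ x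
  decode-encode (i , s) = ≡.subst (_∼ (i , s))
    (≡.trans
      (≡.sym (≡.cong₂ _,_ (Fin.toℕ-fromℕ< (ℕ.m%n<n i N)) (flag-unflag s)))
      (≡.sym (≡.cong reduced (Fin.remQuot-combine {N} (fromℕ< (ℕ.m%n<n i N)) (unflag s)))))
    (ℕ.m%n%n≡m%n i N , s)

  origin : State
  origin = 0 , false

  act-word : ∀ x → act (word x) origin ∼ x
  act-word (i , false) = ∼-trans (act-aⁿ-false i 0) (≡⇒∼ (ℕ.+-identityʳ i))
  act-word (i , true)  =
    act-cong b (∼-trans (act-aⁿ-false i 0) (≡⇒∼ (ℕ.+-identityʳ i)))

  enumeration : Inverse (≡.setoid (Fin (4 ℕ.* m))) setoid
  enumeration = ≡.subst (λ n → Inverse (≡.setoid (Fin n)) setoid) (eq m) (record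
    { to        = word ∘ decode
    ; from      = λ w → encode (act w origin)
    ; to-cong   = λ { ≡.refl → refl }
    ; from-cong = λ p → encode-cong (act-≈ p origin)
    ; inverse   =
        (λ { {w} ≡.refl → trans (word-cong (decode-encode (act w origin)))
                            (trans (word-act w origin) (identityˡ w)) })
      , (λ {t} p → ≡.trans (encode-cong (∼-trans (act-≈ p origin) (act-word (decode t))))
                     (encode-decode t))
    })
    where
    eq : ∀ m → 2 ℕ.* m ℕ.* 2 ≡ 4 ℕ.* m
    eq = solve-∀

  1≢0 : ¬ 1 ≋ 0
  1≢0 p with () ← ≡.trans (≡.sym (ℕ.m<n⇒m%n≡m (ℕ.*-monoʳ-≤ 2 (s≤s (z≤n {k}))))) p

  a≉ε : ¬ a ≈ ε
  a≉ε p with act-≈ p origin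
  ... | 1≋0 , _ = 1≢0 1≋0

  a⁻¹≉ε : ¬ a ⁻¹ ≈ ε
  a⁻¹≉ε p = a≉ε (begin
    a          ≈⟨ identityʳ a ⟨
    a ∙ ε      ≈⟨ ∙-congˡ p ⟨
    a ∙ a ⁻¹   ≈⟨ inverseʳ a ⟩
    ε          ∎)

  b≉ε : ¬ b ≈ ε
  b≉ε p with () ← act-≈ p origin

Q-enumeration : ∀ m → 2 ℕ.≤ m → Inverse (≡.setoid (Fin (4 ℕ.* m))) (Group.setoid (Q m))
Q-enumeration (suc k) _ = NormalForm.enumeration k

generators : List (Word Generator)
generators = a ∷ a ⁻¹ ∷ b ∷ []

ε∉generators : ∀ m → 2 ℕ.≤ m → let open Membership (Group.setoid (Q m)) in ¬ ε ∈ generators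
ε∉generators m@(suc k) _ = λ
  { (here p)                 → a≉ε (sym p)
  ; (there (here p))         → a⁻¹≉ε (sym p)
  ; (there (there (here p))) → b≉ε (sym p)
  }
  where
  open NormalForm k
  open Presentation (QuaternionRelation m) using (sym)

QuaternionCayley : (m : ℕ) → 2 ℕ.≤ m → FiniteDigraph 0ℓ 0ℓ 0ℓ
QuaternionCayley m 2≤m = Cayley (Q m) (Q-enumeration m 2≤m) generators (ε∉generators m 2≤m)

{-# OPTIONS --safe #-}
module Submission where

open import Defs
open import Algebra.Bundles using (CommutativeRing; Group)
import Algebra.Properties.Group as GroupProperties
import Algebra.Properties.Semiring.Mult as SemiringMult
import Algebra.Properties.Semiring.Sum as SemiringSum
import Algebra.Solver.Ring.NaturalCoefficients.Default as SemiringSolver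
open import Data.Bool.Base as Bool using (T)
open import Data.Fin.Base as Fin using (Fin; zero; suc)
open import Data.Fin.Patterns using (0F; 1F; 2F; 3F; 4F)
import Data.Fin.Properties as Fin
open import Data.List.Base as List using ([]; _∷_)
import Data.List.Membership.Setoid as Membership
import Data.List.Membership.Setoid.Properties as MembershipProperties
open import Data.List.Relation.Unary.All using (All; []; _∷_)
import Data.List.Relation.Unary.All.Properties as All
open import Data.List.Relation.Unary.AllPairs using (_∷_)
open import Data.List.Relation.Unary.Any using (here; there; index)
open import Data.List.Relation.Unary.Unique.Setoid using (Unique)
import Data.List.Relation.Unary.Unique.Setoid.Properties as Unique
open import Data.Nat.Base as ℕ using (ℕ; zero; suc; z≤n; s≤s; NonZero)
import Data.Nat.DivMod as ℕ
open import Data.Nat.Induction using (<-rec)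
import Data.Nat.Properties as ℕ
open import Data.Product.Base using (Σ-syntax; ∃-syntax; _×_; _,_; proj₁; proj₂)
open import Data.Sum.Base using (_⊎_; inj₁; inj₂; [_,_]′)
open import Data.Vec.Base as Vec using ([]; _∷_)
open import Function.Base using (_∘_)
open import Function.Bundles using (Inverse)
open import Level using (_⊔_)
open import Relation.Binary.Bundles using (Setoid)
open import Relation.Binary.PropositionalEquality.Core as ≡ using (_≡_; _≢_)
import Relation.Binary.Reasoning.Setoid as SetoidReasoning
open import Relation.Nullary.Decidable using (Dec; yes; no; map′; _×-dec_)
open import Relation.Nullary.Negation using (¬_; contradiction)

-- The potential d(z,·) is 1-Lipschitz, so by Kantorovich duality a coupling
-- is optimal as soon as it moves mass only along geodesics that extend
-- geodesics from one fixed vertex z.  Write β = (1 - α)/3.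
--
-- For (e,b) take z = e and send e → b with mass α, and a → ab,
-- a⁻¹ → a⁻¹b, b → b² with mass β each.  Every step has length 1, so
-- W = α + 3β = 1.
--
-- For (e,a) take z = a⁻¹, leave mass β at e and at a, and send e → a with
-- mass α - β, and b → ab, a⁻¹ → a² with mass β each.  All steps have length
-- 1 except the last, of length D = d(e,a³), so W = α + Dβ = 1 - (3 - D)β.
-- Here D = 1 for m = 2 (a³ = a⁻¹), D = 2 for m = 3 (a³ = b²), and D = 3
-- for m ≥ 4.

-- Ordered-field arithmetic without trichotomy, and division by natural numbers.

module Reals {c ℓ₁ ℓ₂} (R : RealField c ℓ₁ ℓ₂) where

  open RealField R public hiding (zero)
  open CommutativeRing commutativeRing public using (commutativeSemiring; semiring)
  open SemiringSum semiring public
    using (sum-cong-≋; sum-replicate-zero; sum-remove; ∑-comm; ∑-distrib-+; *-distribˡ-sum; *-distribʳ-sum)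
  open SemiringMult semiring public using (×-homo-+)
  open SemiringSolver commutativeSemiring public using (Polynomial; solve; _:+_; _:*_; _:=_; con)
  open SetoidReasoning setoid public

  numeral : ∀ {k} → ℕ → Polynomial k
  numeral zero    = con 0
  numeral (suc n) = con 1 :+ numeral n

  <-respˡ : ∀ {x y z} → x ≈ y → x < z → y < z
  <-respˡ = <-SPO.<-respˡ-≈

  <-respʳ : ∀ {x y z} → y ≈ z → x < y → x < z
  <-respʳ = <-SPO.<-respʳ-≈

  <-irrefl : ∀ {x} → ¬ x < x
  <-irrefl = <-SPO.irrefl refl

  -- The substitute for trichotomy. Cotransitivity of apartness separates `z` from one endpoint, and
  -- `x<y` repairs the orientation that points outwards.
  <-cotrans : ∀ {x y} → x < y → ∀ z → x < z ⊎ z < y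
  <-cotrans x<y z with #-cotrans (<⇒# x<y) z
  ... | inj₁ x#z = [ inj₁ , (λ z<x → inj₂ (<-SPO.trans z<x x<y)) ]′ (#⇒<⊎> x#z)
  ... | inj₂ z#y = [ inj₂ , (λ y<z → inj₁ (<-SPO.trans x<y y<z)) ]′ (#⇒<⊎> z#y)

  ≤-reflexive : ∀ {x y} → x ≈ y → x ≤ y
  ≤-reflexive x≈y = <-SPO.irrefl (sym x≈y)

  <⇒≤ : ∀ {x y} → x < y → x ≤ y
  <⇒≤ x<y y<x = <-irrefl (<-SPO.trans x<y y<x)

  -- Since `_≤_` is a negation, the proof is a refutation: a strict `z < x` is cut at `y` by
  -- `<-cotrans`, and each piece is excluded.
  ≤-trans : ∀ {x y z} → x ≤ y → y ≤ z → x ≤ z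
  ≤-trans {y = y} x≤y y≤z z<x = [ y≤z , x≤y ]′ (<-cotrans z<x y)

  -x+[x+y]≈y : ∀ x y → - x + (x + y) ≈ y
  -x+[x+y]≈y x y = begin
    - x + (x + y) ≈⟨ +-assoc (- x) x y ⟨
    - x + x + y   ≈⟨ +-congʳ (-‿inverseˡ x) ⟩
    0# + y        ≈⟨ +-identityˡ y ⟩
    y             ∎

  +-cancelˡ-< : ∀ x {y z} → x + y < x + z → y < z
  +-cancelˡ-< x x+y<x+z = <-respˡ (-x+[x+y]≈y x _) (<-respʳ (-x+[x+y]≈y x _) (+-monoʳ-< (- x) x+y<x+z))

  +-monoʳ-≤ : ∀ x {y z} → y ≤ z → x + y ≤ x + z
  +-monoʳ-≤ x y≤z = y≤z ∘ +-cancelˡ-< x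

  +-cancelʳ-≤ : ∀ {x y} z → x + z ≤ y + z → x ≤ y
  +-cancelʳ-≤ z x+z≤y+z y<x =
    x+z≤y+z (<-respˡ (+-comm z _) (<-respʳ (+-comm z _) (+-monoʳ-< z y<x)))

  +-mono-≤ : ∀ {x y u v} → x ≤ y → u ≤ v → x + u ≤ y + v
  +-mono-≤ {x} {y} {u} {v} x≤y u≤v =
    ≤-trans (+-monoʳ-≤ x u≤v)
      (≤-trans (≤-reflexive (+-comm x v))
        (≤-trans (+-monoʳ-≤ v x≤y) (≤-reflexive (+-comm v y))))

  [x-y]+y≈x : ∀ x y → x - y + y ≈ x
  [x-y]+y≈x x y = begin
    x - y + y     ≈⟨ +-assoc x (- y) y ⟩
    x + (- y + y) ≈⟨ +-congˡ (-‿inverseˡ y) ⟩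
    x + 0#        ≈⟨ +-identityʳ x ⟩
    x             ∎

  x+z≈y⇒y-x≈z : ∀ {x y z} → x + z ≈ y → y - x ≈ z
  x+z≈y⇒y-x≈z {x} {y} {z} x+z≈y =
    trans (+-comm y (- x)) (trans (+-congˡ (sym x+z≈y)) (-x+[x+y]≈y x z))

  y≤x⇒0≤x-y : ∀ {x y} → y ≤ x → 0# ≤ x - y
  y≤x⇒0≤x-y {x} {y} y≤x = +-cancelʳ-≤ y
    (≤-trans (≤-reflexive (+-identityˡ y)) (≤-trans y≤x (≤-reflexive (sym ([x-y]+y≈x x y)))))

  sum-mono : ∀ {n} {f g : Fin n → Carrier} → (∀ i → f i ≤ g i) → sum f ≤ sum g
  sum-mono {zero}  f≤g = <-irrefl
  sum-mono {suc n} f≤g = +-mono-≤ (f≤g zero) (sum-mono (f≤g ∘ suc))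

  sum-nonneg : ∀ {n} {f : Fin n → Carrier} → (∀ i → 0# ≤ f i) → 0# ≤ sum f
  sum-nonneg {n} 0≤f = ≤-trans (≤-reflexive (sym (sum-replicate-zero n))) (sum-mono 0≤f)

  sum-zero : ∀ {n} {f : Fin n → Carrier} → (∀ i → f i ≈ 0#) → sum f ≈ 0#
  sum-zero {n} f≈0 = trans (sum-cong-≋ f≈0) (sum-replicate-zero n)

  sum-single : ∀ {n} (f : Fin n → Carrier) i → (∀ j → j ≢ i → f j ≈ 0#) → sum f ≈ f i
  sum-single {suc n} f i f≈0 = trans (sum-remove {i = i} f)
    (trans (+-congˡ (sum-zero λ j → f≈0 (Fin.punchIn i j) (Fin.punchInᵢ≢i i j))) (+-identityʳ (f i)))

  fromℕ-cong : ∀ {i j} → i ≡ j → fromℕ i ≈ fromℕ j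
  fromℕ-cong = reflexive ∘ ≡.cong fromℕ

  *-fromℕ-1 : ∀ x → x * fromℕ 1 ≈ x
  *-fromℕ-1 x = trans (*-congˡ (+-identityʳ 1#)) (*-identityʳ x)

  *-fromℕ-suc : ∀ x n → x * fromℕ (suc n) ≈ x + x * fromℕ n
  *-fromℕ-suc x n = trans (distribˡ x 1# (fromℕ n)) (+-congʳ (*-identityʳ x))

  *-fromℕ-mono : ∀ {x m n} → 0# ≤ x → m ℕ.≤ n → x * fromℕ m ≤ x * fromℕ n
  *-fromℕ-mono {x} {n = n} 0≤x z≤n = ≤-trans (≤-reflexive (zeroʳ x)) (nonneg n)
    where
    nonneg : ∀ n → 0# ≤ x * fromℕ n
    nonneg zero    = ≤-reflexive (sym (zeroʳ x))
    nonneg (suc n) = ≤-trans (≤-reflexive (sym (+-identityʳ 0#)))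
      (≤-trans (+-mono-≤ 0≤x (nonneg n)) (≤-reflexive (sym (*-fromℕ-suc x n))))
  *-fromℕ-mono {x} {suc m} {suc n} 0≤x (s≤s m≤n) =
    ≤-trans (≤-reflexive (*-fromℕ-suc x m))
      (≤-trans (+-monoʳ-≤ x (*-fromℕ-mono 0≤x m≤n)) (≤-reflexive (sym (*-fromℕ-suc x n))))

  -- Stated for strict negatives because `_≤_` is a negation: `/ℕ-nonneg` refutes a negative
  -- quotient by multiplying it back.
  *-fromℕ-neg : ∀ {x} n → x < 0# → x * fromℕ (suc n) < 0#
  *-fromℕ-neg {x} zero    x<0 =
    <-respˡ (sym (*-fromℕ-1 x)) x<0
  *-fromℕ-neg {x} (suc n) x<0 = <-respˡ (sym (*-fromℕ-suc x (suc n)))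
    (<-SPO.trans (<-respʳ (+-identityʳ x) (+-monoʳ-< x (*-fromℕ-neg n x<0))) x<0)

  x*x⁻¹≈1 : ∀ {x} (x#0 : x # 0#) → x * (x ⁻¹[ x#0 ]) ≈ 1#
  x*x⁻¹≈1 {x} x#0 = trans (*-congʳ (sym x-0≈x)) (proj₂ (proj₂ (#⇒invertible x#0)))
    where
    x-0≈x : x - 0# ≈ x
    x-0≈x = x+z≈y⇒y-x≈z (+-identityˡ x)

  /ℕ-* : ∀ x n .{{_ : NonZero n}} → (x /ℕ n) * fromℕ n ≈ x
  /ℕ-* x (suc n) = trans (*-assoc x _ _)
    (trans (*-congˡ (trans (*-comm _ _) (x*x⁻¹≈1 (pos⇒#0 (fromℕ-pos n))))) (*-identityʳ x))

  /ℕ-unique : ∀ {x y} n .{{_ : NonZero n}} → y * fromℕ n ≈ x → y ≈ x /ℕ n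
  /ℕ-unique {x} {y} (suc n) yn≈x = sym (trans (*-congʳ (sym yn≈x))
    (trans (*-assoc y _ _) (trans (*-congˡ (x*x⁻¹≈1 (pos⇒#0 (fromℕ-pos n)))) (*-identityʳ y))))

  /ℕ-nonneg : ∀ {x} n .{{_ : NonZero n}} → 0# ≤ x → 0# ≤ x /ℕ n
  /ℕ-nonneg {x} n@(suc n-1) 0≤x x/n<0 = 0≤x (<-respˡ (/ℕ-* x n) (*-fromℕ-neg n-1 x/n<0))

  /ℕ-congʳ : ∀ x {m n} .{{_ : NonZero m}} .{{_ : NonZero n}} → m ≡ n → x /ℕ m ≈ x /ℕ n
  /ℕ-congʳ x ≡.refl = refl

  ½ : Carrier
  ½ = 1# /ℕ 2

  ½+½≈1 : ½ + ½ ≈ 1#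
  ½+½≈1 = trans (solve 1 (λ h → h :+ h := h :* numeral 2) refl ½) (/ℕ-* 1# 2)

  0<½ : 0# < ½
  0<½ with <-cotrans 0<1 ½
  ... | inj₁ 0<½ = 0<½
  -- Adding `½` gives `1# ≈ ½ + ½ < 1# + ½`, and cancelling `1#` leaves `0# < ½`.
  ... | inj₂ ½<1 = +-cancelˡ-< 1#
    (<-respˡ (trans ½+½≈1 (sym (+-identityʳ 1#))) (<-respʳ (+-comm ½ 1#) (+-monoʳ-< ½ ½<1)))

  -- Half suffices for the coupling along (e , a), which needs (1 - α) / 3 ≤ α.
  1-½<α⇒1-α≤α : ∀ {α} → 1# - ½ < α → 1# - α ≤ α
  1-½<α⇒1-α≤α {α} 1-½<α = <⇒≤ (<-SPO.trans 1-α<½ ½<α)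
    where
    ½<α : ½ < α
    ½<α = <-respˡ (x+z≈y⇒y-x≈z ½+½≈1) 1-½<α
    1-α<½ : 1# - α < ½
    1-α<½ = +-cancelˡ-< α
      (<-respˡ (trans ½+½≈1 (sym (trans (+-comm α _) ([x-y]+y≈x 1# α))))
        (<-respʳ (+-comm ½ α) (+-monoʳ-< ½ ½<α)))

-- Least witnesses, and lists without repetition.

least : ∀ {p} {P : ℕ → Set p} → (∀ n → Dec (P n)) → ∀ n → P n →
        ∃[ k ] P k × (∀ j → P j → k ℕ.≤ j)
least {P = P} P? = <-rec _ step
  where
  step : ∀ n → (∀ {k} → k ℕ.< n → P k → ∃[ k ] P k × (∀ j → P j → k ℕ.≤ j)) →
         P n → ∃[ k ] P k × (∀ j → P j → k ℕ.≤ j)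
  -- The bounded search either finds a smaller witness to recurse on or certifies that `n` is least.
  step n rec Pn with ℕ.anyUpTo? P? n
  ... | yes (k , k<n , Pk) = rec k<n Pk
  ... | no none            = n , Pn , λ j Pj → ℕ.≮⇒≥ (λ j<n → none (j , j<n , Pj))

module _ {a ℓ} (S : Setoid a ℓ) where

  open Setoid S
  open MembershipProperties using (∈-lookup; ∈-resp-≈)

  Unique⇒lookup-injective : ∀ {xs} → Unique S xs → ∀ i j → List.lookup xs i ≈ List.lookup xs j → i ≡ j
  Unique⇒lookup-injective (x∉xs ∷ xs!) zero    zero    eq = ≡.refl
  Unique⇒lookup-injective {_ ∷ xs} (x∉xs ∷ xs!) zero    (suc j) eq =
    contradiction (∈-resp-≈ S (sym eq) (∈-lookup S xs j)) (All.All¬⇒¬Any x∉xs)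
  Unique⇒lookup-injective {_ ∷ xs} (x∉xs ∷ xs!) (suc i) zero    eq =
    contradiction (∈-resp-≈ S eq (∈-lookup S xs i)) (All.All¬⇒¬Any x∉xs)
  Unique⇒lookup-injective (x∉xs ∷ xs!) (suc i) (suc j) eq =
    ≡.cong suc (Unique⇒lookup-injective xs! i j eq)

-- Walks, distances and out-neighbourhoods in a finite digraph.

module Digraph {v ℓ r} (Γ : FiniteDigraph v ℓ r) where

  open FiniteDigraph Γ public

  index-of : Vertex → Fin order
  index-of = Inverse.from enumeration

  vertex-index : ∀ u → vertex (index-of u) ≈ u
  vertex-index u = Inverse.inverseˡ enumeration ≡.refl

  vertex-injective : ∀ {i j} → vertex i ≈ vertex j → i ≡ j
  vertex-injective {i} {j} eq =
    ≡.trans (≡.sym (Inverse.inverseʳ enumeration ≈-refl)) (Inverse.inverseʳ enumeration eq)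

  walk-respˡ : ∀ {u u′ w n} → u ≈ u′ → Walk u w n → Walk u′ w n
  walk-respˡ u≈u′ (stop u≈w)   = stop (≈-trans (≈-sym u≈u′) u≈w)
  walk-respˡ u≈u′ (step arc p) = step (proj₂ ⟶-resp u≈u′ arc) p

  infixr 5 _++ʷ_

  _++ʷ_ : ∀ {t u w m n} → Walk t u m → Walk u w n → Walk t w (m ℕ.+ n)
  stop t≈u   ++ʷ q = walk-respˡ (≈-sym t≈u) q
  step arc p ++ʷ q = step arc (p ++ʷ q)

  arc-walk : ∀ {u w} → u ⟶ w → Walk u w 1
  arc-walk arc = step arc (stop ≈-refl)

  -- The second vertex of a walk can be replaced by its representative `vertex i`, so only finitely
  -- many continuations have to be tried.
  walk? : ∀ n u w → Dec (Walk u w n)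
  walk? zero    u w = map′ stop (λ { (stop u≈w) → u≈w }) (u ≈? w)
  walk? (suc n) u w = map′
    (λ { (i , arc , p) → step arc p })
    (λ { (step {v = t} arc p) → index-of t
       , proj₁ ⟶-resp (≈-sym (vertex-index t)) arc
       , walk-respˡ (≈-sym (vertex-index t)) p })
    (Fin.any? λ i → (u ⟶? vertex i) ×-dec walk? n (vertex i) w)

  -- The length of any connecting walk starts the search of `least`; this needs `walk?` to decide
  -- each smaller length.
  shortest-walks : (∀ u w → ∃[ n ] Walk u w n) → Σ[ d ∈ (Vertex → Vertex → ℕ) ] IsDistance d
  shortest-walks connected = (λ u w → proj₁ (shortestWalk u w)) , record
    { attained = λ u w → proj₁ (proj₂ (shortestWalk u w))
    ; shortest = λ u w → proj₂ (proj₂ (shortestWalk u w))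
    }
    where
    shortestWalk : ∀ u w → ∃[ k ] Walk u w k × (∀ j → Walk u w j → k ℕ.≤ j)
    shortestWalk u w = least (λ n → walk? n u w) _ (proj₂ (connected u w))

  module Distance {d : Vertex → Vertex → ℕ} (isDistance : IsDistance d) where

    open IsDistance isDistance public

    triangle : ∀ t u w → d t w ℕ.≤ d t u ℕ.+ d u w
    triangle t u w = shortest t w _ (attained t u ++ʷ attained u w)

    d-cong : ∀ {u u′ w w′} → u ≈ u′ → w ≈ w′ → d u w ≡ d u′ w′
    d-cong u≈u′ w≈w′ = ℕ.≤-antisym (le (≈-sym u≈u′) (≈-sym w≈w′)) (le u≈u′ w≈w′)
      where
      le : ∀ {u u′ w w′} → u′ ≈ u → w ≈ w′ → d u w′ ℕ.≤ d u′ w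
      le {u} {u′} {w} {w′} u′≈u w≈w′ = shortest u w′ _
        (≡.subst (Walk u w′) (ℕ.+-identityʳ _)
          (walk-respˡ u′≈u (attained u′ w) ++ʷ stop w≈w′))

    -- The concatenated walk cannot be undercut, so both pieces are geodesics. Two explicit walks
    -- and one lower bound thus give the length of a transport leg together with the equality that
    -- makes it optimal, without computing `d` first.
    geodesic-split : ∀ {t u w i j} → Walk t u i → Walk u w j →
      (∀ n → Walk t w n → i ℕ.+ j ℕ.≤ n) → d u w ≡ j × d t u ℕ.+ d u w ≡ d t w
    geodesic-split {t} {u} {w} {i} {j} p q i+j≤ =
        -- Cancel `i` in `i + j ≤ d t w ≤ d t u + d u w ≤ i + d u w`.
        ℕ.≤-antisym duw≤j (ℕ.+-cancelˡ-≤ i j (d u w) (ℕ.≤-trans i+j≤dtw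
          (ℕ.≤-trans (triangle t u w) (ℕ.+-monoˡ-≤ (d u w) dtu≤i))))
      , ℕ.≤-antisym (ℕ.≤-trans (ℕ.+-mono-≤ dtu≤i duw≤j) i+j≤dtw) (triangle t u w)
      where
      dtu≤i : d t u ℕ.≤ i
      dtu≤i = shortest t u i p
      duw≤j : d u w ℕ.≤ j
      duw≤j = shortest u w j q
      i+j≤dtw : i ℕ.+ j ℕ.≤ d t w
      i+j≤dtw = i+j≤ _ (attained t w)

  -- An explicit listing of the out-neighbours without repetition. It stands in for `outNeighbours`,
  -- which filters an enumeration and does not evaluate for an abstract graph.
  record IsOutNeighbourhood (x : Vertex) {n} (nbr : Fin n → Vertex) : Set (v ⊔ ℓ ⊔ r) where
    field
      injective : ∀ {i j} → nbr i ≈ nbr j → i ≡ j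
      arc       : ∀ i → x ⟶ nbr i
      only      : ∀ {w} → x ⟶ w → ∃[ i ] w ≈ nbr i

    open Membership vertices using (_∈_)

    nbr∈out : ∀ i → nbr i ∈ outNeighbours x
    nbr∈out i = MembershipProperties.∈-filter⁺ vertices (x ⟶?_) (proj₁ ⟶-resp)
      (MembershipProperties.∈-resp-≈ vertices (vertex-index (nbr i))
        (MembershipProperties.∈-tabulate⁺ vertices (index-of (nbr i))))
      (arc i)

    which : ∀ j → ∃[ i ] List.lookup (outNeighbours x) j ≈ nbr i
    which j = only (proj₂ (MembershipProperties.∈-filter⁻ vertices (x ⟶?_) (proj₁ ⟶-resp)
      {xs = List.tabulate vertex} (MembershipProperties.∈-lookup vertices (outNeighbours x) j)))

    -- Two injections: a position in `outNeighbours x` goes to the index of its vertex in `nbr`, and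
    -- an index goes to a position holding its vertex. The first is injective because filtering an
    -- enumeration creates no repetition.
    outdeg≡ : outdeg x ≡ n
    outdeg≡ = ℕ.≤-antisym
      (Fin.injective⇒≤ {f = λ j → proj₁ (which j)} λ {j} {k} eq →
        Unique⇒lookup-injective vertices
          (Unique.filter⁺ vertices (x ⟶?_) (Unique.tabulate⁺ vertices vertex-injective)) j k
          (≈-trans (proj₂ (which j)) (≈-trans (≈-reflexive (≡.cong nbr eq)) (≈-sym (proj₂ (which k))))))
      (Fin.injective⇒≤ {f = λ i → index (nbr∈out i)} λ {i} {j} eq →
        injective (MembershipProperties.index-injective vertices (nbr∈out i) (nbr∈out j) eq))
      where
      ≈-reflexive : ∀ {u w} → u ≡ w → u ≈ w
      ≈-reflexive ≡.refl = ≈-refl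

-- Point masses, Kantorovich duality and optimal transport plans.

module Transport {c ℓ₁ ℓ₂} (R : RealField c ℓ₁ ℓ₂) {v ℓ r} (Γ : FiniteDigraph v ℓ r) where

  open Reals R
  open Digraph Γ using (Vertex; order; vertex; index-of; vertex-index; vertex-injective; _≈?_; _⟶_; _⟶?_;
    ⟶-resp; ⟶-irrefl; ≈-refl; ≈-sym; ≈-trans; IsDistance; IsOutNeighbourhood; module IsOutNeighbourhood; module Distance)
    renaming (_≈_ to _≈ᵛ_)
  open Curvature R Γ

  𝟙 : ∀ {p} {P : Set p} → Dec P → Carrier
  𝟙 (yes _) = 1#
  𝟙 (no _)  = 0#

  -- The point mass at `p`, evaluated at `u`.
  ind : Vertex → Vertex → Carrier
  ind p u = 𝟙 (p ≈? u)

  ind-yes : ∀ {p u} → p ≈ᵛ u → ind p u ≈ 1#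
  ind-yes {p} {u} p≈u with p ≈? u
  ... | yes _  = refl
  ... | no p≉u = contradiction p≈u p≉u

  ind-no : ∀ {p u} → ¬ p ≈ᵛ u → ind p u ≈ 0#
  ind-no {p} {u} p≉u with p ≈? u
  ... | yes p≈u = contradiction p≈u p≉u
  ... | no _    = refl

  ind-cong : ∀ {p u u′} → u ≈ᵛ u′ → ind p u ≈ ind p u′
  ind-cong {p} {u} u≈u′ with p ≈? u
  ... | yes p≈u = sym (ind-yes (≈-trans p≈u u≈u′))
  ... | no p≉u  = sym (ind-no λ p≈u′ → p≉u (≈-trans p≈u′ (≈-sym u≈u′)))

  ind-nonneg : ∀ {x} p u → 0# ≤ x → 0# ≤ x * ind p u
  ind-nonneg {x} p u 0≤x with p ≈? u
  ... | yes _ = ≤-trans 0≤x (≤-reflexive (sym (*-identityʳ x)))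
  ... | no _  = ≤-reflexive (sym (zeroʳ x))

  ind-≤ : ∀ {x} p u → 0# ≤ x → x * ind p u ≤ x
  ind-≤ {x} p u 0≤x with p ≈? u
  ... | yes _ = ≤-reflexive (*-identityʳ x)
  ... | no _  = ≤-trans (≤-reflexive (zeroʳ x)) 0≤x

  -- Only the summand at `index-of p` survives. Its vertex is merely equivalent to `p`, hence the
  -- congruence condition on `h`.
  sift : ∀ p (h : Vertex → Carrier) → (∀ {u u′} → u ≈ᵛ u′ → h u ≈ h u′) →
         ∑ (λ u → ind p u * h u) ≈ h p
  sift p h h-cong = begin
    ∑ (λ u → ind p u * h u)   ≈⟨ sum-single _ i vanish ⟩
    ind p (vertex i) * h (vertex i)
      ≈⟨ *-cong (ind-yes (≈-sym (vertex-index p))) (h-cong (vertex-index p)) ⟩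
    1# * h p                  ≈⟨ *-identityˡ (h p) ⟩
    h p                       ∎
    where
    i = index-of p
    vanish : ∀ j → j ≢ i → ind p (vertex j) * h (vertex j) ≈ 0#
    vanish j j≢i = trans (*-congʳ (ind-no λ p≈j →
      j≢i (vertex-injective (≈-trans (≈-sym p≈j) (≈-sym (vertex-index p)))))) (zeroˡ _)

  -- Integration against a combination of point masses: exchange the sums, then sift each term.
  -- Letting `h` depend on `k` makes marginals, costs and potentials instances of one identity.
  ∑-points : ∀ {n} (m : Fin n → Carrier) (p : Fin n → Vertex) (h : Fin n → Vertex → Carrier) →
             (∀ k {u u′} → u ≈ᵛ u′ → h k u ≈ h k u′) →
             ∑ (λ u → sum λ k → m k * ind (p k) u * h k u) ≈ sum λ k → m k * h k (p k)
  ∑-points m p h h-cong = begin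
    ∑ (λ u → sum λ k → m k * ind (p k) u * h k u)
      ≈⟨ ∑-comm (λ i k → m k * ind (p k) (vertex i) * h k (vertex i)) ⟩
    sum (λ k → ∑ λ u → m k * ind (p k) u * h k u)
      ≈⟨ sum-cong-≋ (λ k → sum-cong-≋ λ i → *-assoc (m k) (ind (p k) (vertex i)) (h k (vertex i))) ⟩
    sum (λ k → ∑ λ u → m k * (ind (p k) u * h k u))
      ≈⟨ sum-cong-≋ (λ k → *-distribˡ-sum (m k) λ i → ind (p k) (vertex i) * h k (vertex i)) ⟨
    sum (λ k → m k * ∑ λ u → ind (p k) u * h k u)
      ≈⟨ sum-cong-≋ (λ k → *-congˡ (sift (p k) (h k) (h-cong k))) ⟩
    sum (λ k → m k * h k (p k)) ∎

  module _ {x n} {nbr : Fin n → Vertex} (hood : IsOutNeighbourhood x nbr) {{_ : NonZero n}} where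

    open IsOutNeighbourhood hood

    -- The terms never overlap: irreflexivity keeps `x` apart from its neighbours, and `injective`
    -- lets at most one neighbour index match `u`. In this form a marginal condition is an identity
    -- in a commutative semiring.
    lazyWalk-points : ∀ α u → lazyWalk α x u ≈
      α * ind x u + sum (λ i → ((1# - α) /ℕ n) * ind (nbr i) u)
    lazyWalk-points α u with x ≈? u | x ⟶? u
    ... | yes x≈u | _ = sym (trans (+-cong (*-identityʳ α) (sum-zero λ i →
      trans (*-congˡ (ind-no λ nbr≈u → ⟶-irrefl (≈-trans x≈u (≈-sym nbr≈u)) (arc i))) (zeroʳ _)))
      (+-identityʳ α))
    ... | no _ | no ¬x⟶u = sym (trans (+-cong (zeroʳ α) (sum-zero λ i →
      trans (*-congˡ (ind-no λ nbr≈u → ¬x⟶u (proj₁ ⟶-resp nbr≈u (arc i)))) (zeroʳ _)))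
      (+-identityʳ 0#))
    ... | no _ | yes x⟶u with only x⟶u
    ...   | i , u≈nbr = trans (/ℕ-congʳ (1# - α) {{_}} {{_}} outdeg≡)
      (sym (trans (+-cong (zeroʳ α) (trans
        (sum-single _ i λ j j≢i → trans (*-congˡ (ind-no λ nbr≈u →
          j≢i (injective (≈-trans nbr≈u u≈nbr)))) (zeroʳ _))
        (trans (*-congˡ (ind-yes (≈-sym u≈nbr))) (*-identityʳ _))))
      (+-identityˡ _)))

  module _ {d : Vertex → Vertex → ℕ} (isDistance : IsDistance d) where

    open Distance isDistance

    potential : Vertex → (Vertex → Carrier) → Carrier
    potential z μ = ∑ λ u → μ u * fromℕ (d z u)

    -- Weak Kantorovich duality for the 1-Lipschitz function d(z,·).
    duality : ∀ z {μ ν} (A : Coupling μ ν) → potential z ν ≤ cost d A + potential z μ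
    duality z {μ} {ν} A = ≤-trans (≤-reflexive ν≈)
      (≤-trans (sum-mono λ i → sum-mono λ j →
        *-fromℕ-mono (0≤plan (vertex i) (vertex j)) (lipschitz (vertex i) (vertex j)))
        (≤-reflexive ≈cost+μ))
      where
      open Coupling A
      lipschitz : ∀ u w → d z w ℕ.≤ d u w ℕ.+ d z u
      lipschitz u w = ≡.subst (d z w ℕ.≤_) (ℕ.+-comm (d z u) (d u w)) (triangle z u w)
      ν≈ : potential z ν ≈ ∑ λ u → ∑ λ w → plan u w * fromℕ (d z w)
      ν≈ = begin
        ∑ (λ w → ν w * fromℕ (d z w))
          ≈⟨ sum-cong-≋ (λ j → *-congʳ (marginalʳ (vertex j))) ⟨
        ∑ (λ w → ∑ (λ u → plan u w) * fromℕ (d z w))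
          ≈⟨ sum-cong-≋ (λ j → *-distribʳ-sum (fromℕ (d z (vertex j))) λ i → plan (vertex i) (vertex j)) ⟩
        ∑ (λ w → ∑ λ u → plan u w * fromℕ (d z w))
          ≈⟨ ∑-comm (λ j i → plan (vertex i) (vertex j) * fromℕ (d z (vertex j))) ⟩
        ∑ (λ u → ∑ λ w → plan u w * fromℕ (d z w)) ∎
      ≈cost+μ : ∑ (λ u → ∑ λ w → plan u w * fromℕ (d u w ℕ.+ d z u)) ≈ cost d A + potential z μ
      ≈cost+μ = begin
        ∑ (λ u → ∑ λ w → plan u w * fromℕ (d u w ℕ.+ d z u))
          ≈⟨ sum-cong-≋ (λ i → sum-cong-≋ {order} λ j →
               trans (*-congˡ (×-homo-+ 1# (d (vertex i) (vertex j)) (d z (vertex i)))) (distribˡ (plan (vertex i) (vertex j)) _ _)) ⟩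
        ∑ (λ u → ∑ λ w → plan u w * fromℕ (d u w) + plan u w * fromℕ (d z u))
          ≈⟨ sum-cong-≋ (λ i → ∑-distrib-+ (λ j → plan (vertex i) (vertex j) * fromℕ (d (vertex i) (vertex j))) _) ⟩
        ∑ (λ u → ∑ (λ w → plan u w * fromℕ (d u w)) + ∑ (λ w → plan u w * fromℕ (d z u)))
          ≈⟨ ∑-distrib-+ (λ i → ∑ λ w → plan (vertex i) w * fromℕ (d (vertex i) w)) _ ⟩
        cost d A + ∑ (λ u → ∑ (λ w → plan u w * fromℕ (d z u)))
          ≈⟨ +-congˡ (sum-cong-≋ λ i → *-distribʳ-sum (fromℕ (d z (vertex i))) λ j → plan (vertex i) (vertex j)) ⟨
        cost d A + ∑ (λ u → ∑ (λ w → plan u w) * fromℕ (d z u))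
          ≈⟨ +-congˡ (sum-cong-≋ λ i → *-congʳ (marginalˡ (vertex i))) ⟩
        cost d A + potential z μ ∎

    -- The geodesic condition turns `duality` into an equality for this plan, so the infimum is
    -- attained. Vertices may repeat among the `p k` and the `q k`, which allows the mass at one
    -- vertex to be split.
    wasserstein-geodesic : ∀ z {n} (m : Fin n → Carrier) (p q : Fin n → Vertex) {μ ν} →
      (∀ k → 0# ≤ m k) → sum m ≈ 1# →
      (∀ u → sum (λ k → m k * ind (p k) u) ≈ μ u) → (∀ w → sum (λ k → m k * ind (q k) w) ≈ ν w) →
      (∀ k → d z (p k) ℕ.+ d (p k) (q k) ≡ d z (q k)) →
      IsWasserstein d μ ν (sum λ k → m k * fromℕ (d (p k) (q k)))
    wasserstein-geodesic z {n} m p q {μ} {ν} 0≤m ∑m≈1 μ≈ ν≈ geodesic = lower , upper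
      where
      B : Coupling μ ν
      B = record
        { plan      = λ u w → sum λ k → m k * ind (p k) u * ind (q k) w
        ; plan-cong = λ u≈u′ w≈w′ → sum-cong-≋ {n} λ k → *-cong (*-congˡ (ind-cong u≈u′)) (ind-cong w≈w′)
        ; 0≤plan    = λ u w → sum-nonneg λ k → ind-nonneg (q k) w (ind-nonneg (p k) u (0≤m k))
        -- Each term is at most `m k`, so an entry is bounded by the total mass 1.
        ; plan≤1    = λ u w → ≤-trans
            (sum-mono λ k → ≤-trans (ind-≤ (q k) w (ind-nonneg (p k) u (0≤m k))) (ind-≤ (p k) u (0≤m k)))
            (≤-reflexive ∑m≈1)
        ; marginalˡ = λ u → trans
            -- A trailing factor `1#` brings the sum into the shape of `∑-points` with constant `h`.
            (sum-cong-≋ λ j → sum-cong-≋ λ k → sym (*-identityʳ (m k * ind (p k) u * ind (q k) (vertex j))))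
            (trans (∑-points (λ k → m k * ind (p k) u) q (λ _ _ → 1#) (λ _ _ → refl))
              (trans (sum-cong-≋ {n} λ k → *-identityʳ _) (μ≈ u)))
        ; marginalʳ = λ w → trans
            (∑-points m p (λ k _ → ind (q k) w) (λ _ _ → refl)) (ν≈ w)
        }
      total : Carrier
      total = sum λ k → m k * fromℕ (d (p k) (q k))
      cost≈ : cost d B ≈ total
      cost≈ = begin
        ∑ (λ u → ∑ λ w → sum (λ k → m k * ind (p k) u * ind (q k) w) * fromℕ (d u w))
          ≈⟨ sum-cong-≋ (λ i → sum-cong-≋ λ j → *-distribʳ-sum (fromℕ (d (vertex i) (vertex j)))
               λ k → m k * ind (p k) (vertex i) * ind (q k) (vertex j)) ⟩
        ∑ (λ u → ∑ λ w → sum (λ k → m k * ind (p k) u * ind (q k) w * fromℕ (d u w)))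
          ≈⟨ sum-cong-≋ (λ i → ∑-points (λ k → m k * ind (p k) (vertex i)) q (λ _ w → fromℕ (d (vertex i) w))
               λ _ w≈w′ → fromℕ-cong (d-cong ≈-refl w≈w′)) ⟩
        ∑ (λ u → sum (λ k → m k * ind (p k) u * fromℕ (d u (q k))))
          ≈⟨ ∑-points m p (λ k u → fromℕ (d u (q k))) (λ _ u≈u′ → fromℕ-cong (d-cong u≈u′ ≈-refl)) ⟩
        total ∎
      potential-points : ∀ {ρ} (s : Fin _ → Vertex) → (∀ u → sum (λ k → m k * ind (s k) u) ≈ ρ u) →
        potential z ρ ≈ sum λ k → m k * fromℕ (d z (s k))
      potential-points {ρ} s ρ≈ = begin
        ∑ (λ u → ρ u * fromℕ (d z u))
          ≈⟨ sum-cong-≋ (λ i → *-congʳ (ρ≈ (vertex i))) ⟨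
        ∑ (λ u → sum (λ k → m k * ind (s k) u) * fromℕ (d z u))
          ≈⟨ sum-cong-≋ (λ i → *-distribʳ-sum (fromℕ (d z (vertex i))) λ k → m k * ind (s k) (vertex i)) ⟩
        ∑ (λ u → sum (λ k → m k * ind (s k) u * fromℕ (d z u)))
          ≈⟨ ∑-points m s (λ _ u → fromℕ (d z u)) (λ _ u≈u′ → fromℕ-cong (d-cong ≈-refl u≈u′)) ⟩
        sum (λ k → m k * fromℕ (d z (s k))) ∎
      tight-duality : total + potential z μ ≈ potential z ν
      tight-duality = begin
        total + potential z μ
          ≈⟨ +-congˡ (potential-points p μ≈) ⟩
        total + sum (λ k → m k * fromℕ (d z (p k)))
          ≈⟨ ∑-distrib-+ (λ k → m k * fromℕ (d (p k) (q k))) _ ⟨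
        sum (λ k → m k * fromℕ (d (p k) (q k)) + m k * fromℕ (d z (p k)))
          ≈⟨ sum-cong-≋ (λ k → trans (+-comm _ _) (trans (sym (distribˡ (m k) _ _)) (*-congˡ
               (trans (sym (×-homo-+ 1# (d z (p k)) _)) (fromℕ-cong (geodesic k)))))) ⟩
        sum (λ k → m k * fromℕ (d z (q k)))
          ≈⟨ potential-points q ν≈ ⟨
        potential z ν ∎
      lower : ∀ t → Σ[ A ∈ Coupling μ ν ] cost d A ≈ t → total ≤ t
      lower t (A , cost≈t) = ≤-trans
        -- By `tight-duality` the bound for `A` reads `total + potential z μ ≤ cost d A + potential
        -- z μ`.
        (+-cancelʳ-≤ (potential z μ) (≤-trans (≤-reflexive tight-duality) (duality z A)))
        (≤-reflexive cost≈t)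
      upper : ∀ e → 0# < e → ∃[ t ] (Σ[ A ∈ Coupling μ ν ] cost d A ≈ t) × t < total + e
      upper e 0<e = total , (B , cost≈) , <-respˡ (+-identityʳ total) (+-monoʳ-< total 0<e)

    -- On the given range the idle curvature is exactly `κ * (1# - α)`, as the distance is 1. The
    -- quotient is therefore constantly `κ`, and the same `δ` serves every error bound.
    hasRicciCurvature : ∀ {x y} κ {δ} → ¬ x ≈ᵛ y → d x y ≡ 1 → 0# < δ →
      (∀ α → 0# ≤ α → 1# - δ < α → α < 1# →
        ∃[ w ] IsWasserstein d (lazyWalk α x) (lazyWalk α y) w × w + κ * (1# - α) ≈ 1#) →
      HasRicciCurvature x y κ
    hasRicciCurvature {x} {y} κ {δ} x≉y dxy≡1 0<δ wasserstein = record
      { distinct   = x≉y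
      ; dist       = d
      ; isDistance = isDistance
      ; limit      = λ e 0<e → δ , 0<δ , λ α 0≤α 1-δ<α α<1 →
          let w , isW , w+κ≈1 = wasserstein α 0≤α 1-δ<α α<1
              1-α#0 = pos⇒#0 (x<y⇒0<y-x α<1)
              k   = 1# - (w /ℕ d x y) {{distinct⇒nonZero x≉y}}
              k≈  = k≈κ[1-α] w α w+κ≈1
              q≈κ = trans (*-congʳ k≈) (trans (*-assoc κ _ _)
                      (trans (*-congˡ (x*x⁻¹≈1 1-α#0)) (*-identityʳ κ)))
          in k * ((1# - α) ⁻¹[ 1-α#0 ]) , (k , (w , isW , refl) , refl) , within q≈κ 0<e
      }
      where
      k≈κ[1-α] : ∀ w α → w + κ * (1# - α) ≈ 1# →
                 1# - (w /ℕ d x y) {{distinct⇒nonZero x≉y}} ≈ κ * (1# - α)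
      k≈κ[1-α] w α w+κ≈1 = x+z≈y⇒y-x≈z (trans (+-congʳ w/1≈w) w+κ≈1)
        where
        w/1≈w : (w /ℕ d x y) {{distinct⇒nonZero x≉y}} ≈ w
        w/1≈w = trans (/ℕ-congʳ w {{distinct⇒nonZero x≉y}} dxy≡1)
          (sym (/ℕ-unique 1 (*-fromℕ-1 w)))
      within : ∀ {s t e} → s ≈ t → 0# < e → Within e s t
      within {s} {t} s≈t 0<e =
          <-respˡ (sym (x+z≈y⇒y-x≈z (trans (+-identityʳ t) (sym s≈t)))) 0<e
        , <-respˡ (sym (x+z≈y⇒y-x≈z (trans (+-identityʳ s) s≈t))) 0<e

    -- Curvature of an arc whose ends have three out-neighbours.

    cost-cong : ∀ {n} (mass : Fin n → Carrier) {i j : Fin n → ℕ} → (∀ k → i k ≡ j k) →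
                sum (λ k → mass k * fromℕ (i k)) ≈ sum (λ k → mass k * fromℕ (j k))
    cost-cong mass i≡j = sum-cong-≋ λ k → *-congˡ (fromℕ-cong (i≡j k))

    -- The start of the arc occurs twice among the sources, with moving mass `γ` and resting mass
    -- `β`. These merge into the idle mass, and the neighbours return to the order of the
    -- out-neighbourhood.
    rearrangeˡ : ∀ γ β e s t u → γ * e + (β * e + (β * s + (β * t + (β * u + 0#)))) ≈
                                  (γ + β) * e + (β * s + (β * u + (β * t + 0#)))
    rearrangeˡ = solve 6 (λ γ β e s t u →
      γ :* e :+ (β :* e :+ (β :* s :+ (β :* t :+ (β :* u :+ con 0)))) :=
      (γ :+ β) :* e :+ (β :* s :+ (β :* u :+ (β :* t :+ con 0)))) refl

    rearrangeʳ : ∀ γ β e s t u → γ * e + (β * s + (β * e + (β * t + (β * u + 0#)))) ≈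
                                  (γ + β) * e + (β * u + (β * s + (β * t + 0#)))
    rearrangeʳ = solve 6 (λ γ β e s t u →
      γ :* e :+ (β :* s :+ (β :* e :+ (β :* t :+ (β :* u :+ con 0)))) :=
      (γ :+ β) :* e :+ (β :* u :+ (β :* s :+ (β :* t :+ con 0)))) refl

    swap₁₂ : ∀ α β e s t u → α * e + (β * s + (β * t + (β * u + 0#))) ≈
                                  α * e + (β * t + (β * s + (β * u + 0#)))
    swap₁₂ = solve 6 (λ α β e s t u →
      α :* e :+ (β :* s :+ (β :* t :+ (β :* u :+ con 0))) :=
      α :* e :+ (β :* t :+ (β :* s :+ (β :* u :+ con 0)))) refl

    -- All legs have length 1, so the cost is the total mass 1 whatever `α` is. The targets exchange
    -- `t₀` and `t₁` because, in the application, right multiplication of `b` by `a` gives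
    -- `a ⁻¹ ∙ b`.
    curvature-perfect-matching : ∀ {x s₀ s₁ y t₀ t₁ t₂} z →
      IsOutNeighbourhood x (Vec.lookup (s₀ ∷ s₁ ∷ y ∷ [])) → IsOutNeighbourhood y (Vec.lookup (t₀ ∷ t₁ ∷ t₂ ∷ [])) →
      let sources = Vec.lookup (x ∷ s₀ ∷ s₁ ∷ y ∷ [])
          targets = Vec.lookup (y ∷ t₁ ∷ t₀ ∷ t₂ ∷ []) in
      (∀ i → d (sources i) (targets i) ≡ 1 × d z (sources i) ℕ.+ d (sources i) (targets i) ≡ d z (targets i)) →
      HasRicciCurvature x y 0#
    curvature-perfect-matching {x} {s₀} {s₁} {y} {t₀} {t₁} {t₂} z x-hood y-hood legs =
      -- This `δ` admits every positive `α` below 1; the masses `α` and `β` are nonnegative on that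
      -- whole range.
      hasRicciCurvature 0# {δ = 1#} (λ x≈y → ⟶-irrefl x≈y (IsOutNeighbourhood.arc x-hood 2F)) (proj₁ (legs 0F)) 0<1 at
      where
      sources targets : Fin 4 → Vertex
      sources = Vec.lookup (x ∷ s₀ ∷ s₁ ∷ y ∷ [])
      targets = Vec.lookup (y ∷ t₁ ∷ t₀ ∷ t₂ ∷ [])
      at : ∀ α → 0# ≤ α → 1# - 1# < α → α < 1# →
        ∃[ w ] IsWasserstein d (lazyWalk α x) (lazyWalk α y) w × w + 0# * (1# - α) ≈ 1#
      at α 0≤α _ α<1 = _
        , wasserstein-geodesic z mass sources targets mass-nonneg mass-total
            (λ u → sym (lazyWalk-points x-hood α u)) marginal-y
            (proj₂ ∘ legs)
        , (begin
          sum (λ i → mass i * fromℕ (d (sources i) (targets i))) + 0# * (1# - α)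
            ≈⟨ +-cong (cost-cong mass {j = λ _ → 1} (proj₁ ∘ legs)) (zeroˡ _) ⟩
          sum (λ i → mass i * fromℕ 1) + 0#
            ≈⟨ +-identityʳ _ ⟩
          sum (λ i → mass i * fromℕ 1)
            ≈⟨ sum-cong-≋ (*-fromℕ-1 ∘ mass) ⟩
          sum mass
            ≈⟨ mass-total ⟩
          1# ∎)
        where
        β : Carrier
        β = (1# - α) /ℕ 3
        0≤β : 0# ≤ β
        0≤β = /ℕ-nonneg 3 (<⇒≤ (x<y⇒0<y-x α<1))
        mass : Fin 4 → Carrier
        mass = Vec.lookup (α ∷ β ∷ β ∷ β ∷ [])
        mass-nonneg : ∀ i → 0# ≤ mass i
        mass-nonneg 0F = 0≤α
        mass-nonneg 1F = 0≤β
        mass-nonneg 2F = 0≤β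
        mass-nonneg 3F = 0≤β
        mass-total : sum mass ≈ 1#
        mass-total = begin
          sum mass         ≈⟨ solve 2 (λ α β → α :+ (β :+ (β :+ (β :+ con 0))) := β :* numeral 3 :+ α) refl α β ⟩
          β * fromℕ 3 + α  ≈⟨ +-congʳ (/ℕ-* (1# - α) 3) ⟩
          1# - α + α       ≈⟨ [x-y]+y≈x 1# α ⟩
          1#               ∎
        marginal-y : ∀ u → sum (λ i → mass i * ind (targets i) u) ≈ lazyWalk α y u
        marginal-y u = begin
          sum (λ i → mass i * ind (targets i) u)
            ≈⟨ swap₁₂ α β (ind y u) (ind t₁ u) (ind t₀ u) (ind t₂ u) ⟩
          α * ind y u + sum (λ i → β * ind (Vec.lookup (t₀ ∷ t₁ ∷ t₂ ∷ []) i) u)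
            ≈⟨ lazyWalk-points y-hood α u ⟨
          lazyWalk α y u ∎

    -- Arcs in both directions let `x` and `y` each keep mass `β`. The number `j` is the saving
    -- `3 - D` in units of `β`, so `κ` is `j / 3`; the product form of this condition treats all
    -- three values alike.
    curvature-mutual-arcs : ∀ {x y s₁ s₂ t₀ t₂} z D j κ →
      IsOutNeighbourhood x (Vec.lookup (y ∷ s₁ ∷ s₂ ∷ [])) → IsOutNeighbourhood y (Vec.lookup (t₀ ∷ x ∷ t₂ ∷ [])) →
      let sources = Vec.lookup (x ∷ x ∷ y ∷ s₂ ∷ s₁ ∷ [])
          targets = Vec.lookup (y ∷ x ∷ y ∷ t₂ ∷ t₀ ∷ [])
          lengths = Vec.lookup (1 ∷ 0 ∷ 0 ∷ 1 ∷ D ∷ []) in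
      (∀ i → d (sources i) (targets i) ≡ lengths i × d z (sources i) ℕ.+ d (sources i) (targets i) ≡ d z (targets i)) →
      D ℕ.+ j ≡ 3 → κ * fromℕ 3 ≈ fromℕ j → HasRicciCurvature x y κ
    curvature-mutual-arcs {x} {y} {s₁} {s₂} {t₀} {t₂} z D j κ x-hood y-hood legs D+j≡3 κ*3≈j =
      hasRicciCurvature κ (λ x≈y → ⟶-irrefl x≈y (IsOutNeighbourhood.arc x-hood 0F)) (proj₁ (legs 0F)) 0<½ at
      where
      sources targets : Fin 5 → Vertex
      sources = Vec.lookup (x ∷ x ∷ y ∷ s₂ ∷ s₁ ∷ [])
      targets = Vec.lookup (y ∷ x ∷ y ∷ t₂ ∷ t₀ ∷ [])
      at : ∀ α → 0# ≤ α → 1# - ½ < α → α < 1# →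
        ∃[ w ] IsWasserstein d (lazyWalk α x) (lazyWalk α y) w × w + κ * (1# - α) ≈ 1#
      at α 0≤α 1-½<α α<1 = _
        , wasserstein-geodesic z mass sources targets mass-nonneg mass-total
            marginal-x marginal-y (proj₂ ∘ legs)
        , (begin
          sum (λ i → mass i * fromℕ (d (sources i) (targets i))) + κ * (1# - α)
            ≈⟨ +-cong (cost-cong mass (proj₁ ∘ legs)) κ[1-α]≈βj ⟩
          sum (λ i → mass i * fromℕ (Vec.lookup (1 ∷ 0 ∷ 0 ∷ 1 ∷ D ∷ []) i)) + β * fromℕ j
            ≈⟨ solve 4 (λ γ β d j →
                 (γ :* numeral 1 :+ (β :* con 0 :+ (β :* con 0 :+ (β :* numeral 1 :+ (β :* d :+ con 0))))) :+ β :* j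
                 := (γ :+ β) :+ β :* (d :+ j)) refl γ β (fromℕ D) (fromℕ j) ⟩
          (γ + β) + β * (fromℕ D + fromℕ j)
            ≈⟨ +-congˡ (*-congˡ (trans (sym (×-homo-+ 1# D j)) (fromℕ-cong D+j≡3))) ⟩
          (γ + β) + β * fromℕ 3
            ≈⟨ total ⟩
          1# ∎)
        where
        β γ : Carrier
        β = (1# - α) /ℕ 3
        γ = α - β
        β*3≈1-α : β * fromℕ 3 ≈ 1# - α
        β*3≈1-α = /ℕ-* (1# - α) 3
        0≤β : 0# ≤ β
        0≤β = /ℕ-nonneg 3 (<⇒≤ (x<y⇒0<y-x α<1))
        0≤γ : 0# ≤ γ
        -- The chain is `β ≤ 3β ≈ 1 - α ≤ α`; its last inequality is the reason for choosing `½` as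
        -- `δ`.
        0≤γ = y≤x⇒0≤x-y (≤-trans
          (≤-reflexive (sym (*-fromℕ-1 β)))
          (≤-trans (*-fromℕ-mono {m = 1} {n = 3} 0≤β (s≤s z≤n))
            (≤-trans (≤-reflexive β*3≈1-α) (1-½<α⇒1-α≤α 1-½<α))))
        γ+β≈α : γ + β ≈ α
        γ+β≈α = [x-y]+y≈x α β
        total : (γ + β) + β * fromℕ 3 ≈ 1#
        total = trans (+-cong γ+β≈α β*3≈1-α) (trans (+-comm α _) ([x-y]+y≈x 1# α))
        κ[1-α]≈βj : κ * (1# - α) ≈ β * fromℕ j
        κ[1-α]≈βj = begin
          κ * (1# - α)      ≈⟨ *-congˡ β*3≈1-α ⟨
          κ * (β * fromℕ 3) ≈⟨ solve 3 (λ κ β t → κ :* (β :* t) := β :* (κ :* t)) refl κ β (fromℕ 3) ⟩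
          β * (κ * fromℕ 3) ≈⟨ *-congˡ κ*3≈j ⟩
          β * fromℕ j       ∎
        mass : Fin 5 → Carrier
        mass = Vec.lookup (γ ∷ β ∷ β ∷ β ∷ β ∷ [])
        mass-nonneg : ∀ i → 0# ≤ mass i
        mass-nonneg 0F = 0≤γ
        mass-nonneg 1F = 0≤β
        mass-nonneg 2F = 0≤β
        mass-nonneg 3F = 0≤β
        mass-nonneg 4F = 0≤β
        mass-total : sum mass ≈ 1#
        mass-total = trans
          (solve 2 (λ γ β → γ :+ (β :+ (β :+ (β :+ (β :+ con 0)))) := (γ :+ β) :+ β :* numeral 3) refl γ β)
          total
        marginal-x : ∀ u → sum (λ i → mass i * ind (sources i) u) ≈ lazyWalk α x u
        marginal-x u = begin
          sum (λ i → mass i * ind (sources i) u)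
            ≈⟨ rearrangeˡ γ β (ind x u) (ind y u) (ind s₂ u) (ind s₁ u) ⟩
          (γ + β) * ind x u + sum (λ i → β * ind (Vec.lookup (y ∷ s₁ ∷ s₂ ∷ []) i) u)
            ≈⟨ +-congʳ (*-congʳ γ+β≈α) ⟩
          α * ind x u + sum (λ i → β * ind (Vec.lookup (y ∷ s₁ ∷ s₂ ∷ []) i) u)
            ≈⟨ lazyWalk-points x-hood α u ⟨
          lazyWalk α x u ∎
        marginal-y : ∀ u → sum (λ i → mass i * ind (targets i) u) ≈ lazyWalk α y u
        marginal-y u = begin
          sum (λ i → mass i * ind (targets i) u)
            ≈⟨ rearrangeʳ γ β (ind y u) (ind x u) (ind t₂ u) (ind t₀ u) ⟩
          (γ + β) * ind y u + sum (λ i → β * ind (Vec.lookup (t₀ ∷ x ∷ t₂ ∷ []) i) u)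
            ≈⟨ +-congʳ (*-congʳ γ+β≈α) ⟩
          α * ind y u + sum (λ i → β * ind (Vec.lookup (t₀ ∷ x ∷ t₂ ∷ []) i) u)
            ≈⟨ lazyWalk-points y-hood α u ⟨
          lazyWalk α y u ∎

-- Arcs, connectedness and distances in the quaternion Cayley graph.

module Quaternion (k : ℕ) (2≤m : 2 ℕ.≤ suc k) where

  m N : ℕ
  m = suc k
  N = 2 ℕ.* m

  open NormalForm k hiding (enumeration)
  open Presentation (QuaternionRelation m)
  open Group (Q m) using (∙-congˡ; ∙-congʳ)
  open Digraph (QuaternionCayley m 2≤m) using
    (Walk; stop; step; IsDistance; IsOutNeighbourhood; arc-walk; _++ʷ_; shortest-walks; _⟶_)

  generator : Fin 3 → Word Generator
  generator = List.lookup generators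

  -- The image of `origin` encodes a normal form equal to the word, so group identities reduce to
  -- comparing two computed states.
  ≈-complete : ∀ u v → act u origin ∼ act v origin → u ≈ v
  ≈-complete u v eq = trans (sym (identityˡ u)) (trans (sym (word-act u origin))
    (trans (word-cong eq) (trans (word-act v origin) (identityˡ v))))

  -- The summand 0 comes from evaluating `b ∙ b` at `origin`, which gives the exponent `m + 0`.
  m+0<N : m ℕ.+ 0 ℕ.< N
  m+0<N = ℕ.+-monoʳ-< m (s≤s z≤n)

  1+m+0<N : suc (m ℕ.+ 0) ℕ.< N
  1+m+0<N = ≡.subst (ℕ._< N) (ℕ.+-suc m 0)
    (ℕ.+-monoʳ-< m (ℕ.≤-trans 2≤m (ℕ.≤-reflexive (≡.sym (ℕ.+-identityʳ m)))))

  4≤N : 4 ℕ.≤ N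
  4≤N = ℕ.*-monoʳ-≤ 2 2≤m

  ≢⇒≋̸ : ∀ {i j} → i ℕ.< N → j ℕ.< N → i ≢ j → ¬ i ≋ j
  ≢⇒≋̸ i<N j<N i≢j p = i≢j
    (≡.trans (≡.sym (ℕ.m<n⇒m%n≡m i<N)) (≡.trans p (ℕ.m<n⇒m%n≡m j<N)))

  ≋̸0 : ∀ {i} → suc i ℕ.< N → ¬ suc i ≋ 0
  ≋̸0 i<N = ≢⇒≋̸ i<N (s≤s z≤n) λ ()

  -- Exponents are natural numbers, with `ℕ.pred N` in the role of -1. Adding 1 to both sides
  -- removes it, so comparisons with negative exponents become comparisons of small numerals.
  ≋-unpred : ∀ {i} j → i ≋ (ℕ.pred N ℕ.+ j) → suc i ≋ j
  ≋-unpred j p = ≡.trans (shift-≋ 1 p) (suc-pred j)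

  apart : ∀ {i j s} → ¬ i ≋ j → ¬ (i , s) ∼ (j , s)
  apart i≋̸j (p , _) = i≋̸j p

  2≋̸0 : ¬ 2 ≋ 0
  2≋̸0 = ≋̸0 (ℕ.<⇒≤ 4≤N)

  2≋̸1 : ¬ 2 ≋ 1
  2≋̸1 = ≢⇒≋̸ (ℕ.<⇒≤ 4≤N) (ℕ.<⇒≤ (ℕ.<⇒≤ 4≤N)) λ ()

  2≋̸-1 : ¬ 2 ≋ (ℕ.pred N ℕ.+ 0)
  2≋̸-1 = ≋̸0 4≤N ∘ ≋-unpred 0

  generator-injective : ∀ {i j} → generator i ≈ generator j → i ≡ j
  generator-injective {i} {j} eq = go i j (act-≈ eq origin)
    where
    go : ∀ i j → act (generator i) origin ∼ act (generator j) origin → i ≡ j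
    go 0F 0F _       = ≡.refl
    -- If `a` and `a ⁻¹` agreed, then `2 ≋ 0`; `b` differs from both in the flag.
    go 0F 1F (p , _) = contradiction (≋-unpred 0 p) 2≋̸0
    go 0F 2F ()
    go 1F 2F ()
    go 1F 0F (p , _) = contradiction (≋-unpred 0 (≡.sym p)) 2≋̸0
    go 1F 1F _       = ≡.refl
    go 2F 2F _       = ≡.refl

  -- Left cancellation transports distinctness of the generators to the neighbours of any vertex.
  out-neighbourhood : ∀ {x} {nbr : Fin 3 → Word Generator} →
    (∀ i → nbr i ≈ x ∙ generator i) → IsOutNeighbourhood x nbr
  out-neighbourhood {x} {nbr} nbr≈ = record
    { injective = λ {i} {j} eq → generator-injective
        (∙-cancelˡ x _ _ (trans (sym (nbr≈ i)) (trans eq (nbr≈ j))))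
    ; arc       = λ where
        0F → here (nbr≈ 0F)
        1F → there (here (nbr≈ 1F))
        2F → there (there (here (nbr≈ 2F)))
    ; only      = λ where
        (here p)                 → 0F , trans p (sym (nbr≈ 0F))
        (there (here p))         → 1F , trans p (sym (nbr≈ 1F))
        (there (there (here p))) → 2F , trans p (sym (nbr≈ 2F))
    }
    where open GroupProperties (Q m) using (∙-cancelˡ)

  ε-hood : IsOutNeighbourhood ε (Vec.lookup (a ∷ a ⁻¹ ∷ b ∷ []))
  ε-hood = out-neighbourhood λ where
    0F → sym (identityˡ a)
    1F → sym (identityˡ (a ⁻¹))
    2F → sym (identityˡ b)

  a-hood : IsOutNeighbourhood a (Vec.lookup (a ∙ a ∷ ε ∷ a ∙ b ∷ []))
  a-hood = out-neighbourhood λ where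
    0F → refl
    1F → sym (inverseʳ a)
    2F → refl

  b-hood : IsOutNeighbourhood b (Vec.lookup (a ⁻¹ ∙ b ∷ a ∙ b ∷ b ∙ b ∷ []))
  b-hood = out-neighbourhood λ where
    -- Both `a ⁻¹ ∙ b` and `b ∙ a` send `origin` to the same state by computation, and so do `a ∙ b`
    -- and `b ∙ a ⁻¹` for the next neighbour.
    0F → ≈-complete _ _ ∼-refl
    1F → ≈-complete _ _ ∼-refl
    2F → refl

  _∙a : ∀ u → Walk u (u ∙ a) 1
  u ∙a = arc-walk (here refl)

  _∙a⁻¹ : ∀ u → Walk u (u ∙ a ⁻¹) 1
  u ∙a⁻¹ = arc-walk (there (here refl))

  _∙b : ∀ u → Walk u (u ∙ b) 1
  u ∙b = arc-walk (there (there (here refl)))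

  -- The state of `u ⁻¹ ∙ w` holds the exponents of its normal form, and spelling that form with
  -- arcs `a` and `b` leads from `u` to `w`.
  connected : ∀ u w → ∃[ n ] Walk u w n
  connected u w = _ , proj₂ (word-walk u (act (u ⁻¹ ∙ w) origin)) ++ʷ stop u∙word≈w
    where
    power-walk : ∀ u i → ∃[ n ] Walk u (u ∙ a ^ i) n
    power-walk u zero    = _ , stop (sym (identityʳ u))
    power-walk u (suc i) = _ , (u ∙a) ++ʷ proj₂ (power-walk (u ∙ a) i) ++ʷ stop (assoc u a (a ^ i))
    word-walk : ∀ u x → ∃[ n ] Walk u (u ∙ word x) n
    word-walk u (i , Bool.false) = power-walk u i
    word-walk u (i , Bool.true)  = _ ,
      proj₂ (power-walk u i) ++ʷ ((u ∙ a ^ i) ∙b) ++ʷ stop (assoc u (a ^ i) b)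
    u∙word≈w : u ∙ word (act (u ⁻¹ ∙ w) origin) ≈ w
    u∙word≈w = trans (∙-congˡ (trans (word-act (u ⁻¹ ∙ w) origin) (identityˡ _)))
      (trans (sym (assoc u (u ⁻¹) w)) (trans (∙-congʳ (inverseʳ u)) (identityˡ w)))

  -- The states reachable in fewer than n steps.
  ball : ℕ → State → List.List State
  ball zero    x = []
  ball (suc n) x = x ∷ ball n (act a x) List.++ ball n (act (a ⁻¹) x) List.++ ball n (act b x)

  -- The state `s` follows the walk: an arc multiplies on the right, hence applies one generator to
  -- `s`, and the rest of the ball consists of the balls around the three successors. Arriving too
  -- early would place `act w x` in the list.
  far : ∀ n {u w x s} → act u x ∼ s → All (λ t → ¬ act w x ∼ t) (ball n s) → ∀ j → Walk u w j → n ℕ.≤ j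
  far zero    _    _          j       _             = z≤n
  far (suc n) ux∼s (wx≁s ∷ _) zero    (stop u≈w)    =
    contradiction (∼-trans (∼-sym (act-≈ u≈w _)) ux∼s) wx≁s
  far (suc n) {u} {w} {x} {s} ux∼s (_ ∷ rest) (suc j) (step {v = v} arc p) = s≤s (next arc)
    where
    via : ∀ g → v ≈ u ∙ g → act v x ∼ act g s
    via g v≈ug = ∼-trans (act-≈ v≈ug x) (act-cong g ux∼s)
    next : u ⟶ v → n ℕ.≤ j
    next (here e)                 = far n (via a e) (All.++⁻ˡ _ rest) j p
    next (there (here e))         = far n (via (a ⁻¹) e)
      (All.++⁻ˡ _ (All.++⁻ʳ (ball n (act a s)) rest)) j p
    next (there (there (here e))) = far n (via b e)
      (All.++⁻ʳ (ball n (act (a ⁻¹) s)) (All.++⁻ʳ (ball n (act a s)) rest)) j p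

  -- Acting on the state of a turns u into a ∙ u, so that walks from a⁻¹ start at the origin.
  far-from-a⁻¹ : ∀ n {w} → All (λ t → ¬ act w (1 , Bool.false) ∼ t) (ball n origin) →
                 ∀ j → Walk (a ⁻¹) w j → n ℕ.≤ j
  far-from-a⁻¹ n = far n (pred-suc 0 , Bool.false)

  far-from-ε : ∀ n {w} → All (λ t → ¬ act w origin ∼ t) (ball n origin) →
               ∀ j → Walk ε w j → n ℕ.≤ j
  far-from-ε n = far n ∼-refl

  ε→a : Walk ε a 1
  ε→a = ε ∙a ++ʷ stop (identityˡ a)

  ε→a⁻¹ : Walk ε (a ⁻¹) 1
  ε→a⁻¹ = ε ∙a⁻¹ ++ʷ stop (identityˡ (a ⁻¹))

  ε→b : Walk ε b 1
  ε→b = ε ∙b ++ʷ stop (identityˡ b)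

  a⁻¹→ε : Walk (a ⁻¹) ε 1
  a⁻¹→ε = (a ⁻¹) ∙a ++ʷ stop (inverseˡ a)

  -- Geodesic legs of the two transport plans.

  sources-b targets-b : Fin 4 → Word Generator
  sources-b = Vec.lookup (ε ∷ a ∷ a ⁻¹ ∷ b ∷ [])
  targets-b = Vec.lookup (b ∷ a ∙ b ∷ a ⁻¹ ∙ b ∷ b ∙ b ∷ [])

  sources-a targets-a : Fin 5 → Word Generator
  sources-a = Vec.lookup (ε ∷ ε ∷ a ∷ b ∷ a ⁻¹ ∷ [])
  targets-a = Vec.lookup (a ∷ ε ∷ a ∷ a ∙ b ∷ a ∙ a ∷ [])

  -- Translated to start at `origin`, the target is `a ^ 3`. This bound and the next two match the
  -- values 1, 2, 3 of `D`.
  far-a²₁ : ∀ j → Walk (a ⁻¹) (a ∙ a) j → 1 ℕ.≤ j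
  far-a²₁ = far-from-a⁻¹ 1 (apart (≋̸0 4≤N) ∷ [])

  far-a²₂ : 3 ℕ.≤ m → ∀ j → Walk (a ⁻¹) (a ∙ a) j → 2 ℕ.≤ j
  far-a²₂ 3≤m = far-from-a⁻¹ 2
    ( apart (≋̸0 4≤N)
    ∷ apart (≢⇒≋̸ 4≤N (ℕ.≤-trans (s≤s (s≤s z≤n)) 4≤N) λ ())
    -- Meeting `a ⁻¹` would mean `4 ≋ 0`, the coincidence that occurs for `m = 2`; here `N` is at
    -- least 6.
    ∷ apart (≋̸0 (ℕ.<⇒≤ (ℕ.*-monoʳ-≤ 2 3≤m)) ∘ ≋-unpred 0)
    ∷ (λ ()) ∷ [])

  far-a²₃ : 4 ℕ.≤ m → ∀ j → Walk (a ⁻¹) (a ∙ a) j → 3 ℕ.≤ j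
  far-a²₃ 4≤m = far-from-a⁻¹ 3
    ( apart 3≋̸0
    ∷ apart 3≋̸1 ∷ apart 3≋̸2 ∷ apart (4≋̸1 ∘ ≋-unpred 1) ∷ (λ ())
    ∷ apart (4≋̸0 ∘ ≋-unpred 0) ∷ apart (3≋̸0 ∘ λ p → ≡.trans p (suc-pred 0))
    ∷ apart (5≋̸0 ∘ ≋-unpred 0 ∘ ≋-unpred (ℕ.pred N ℕ.+ 0)) ∷ (λ ())
    -- The last state is that of `b ∙ b`, equal to `a ^ m`. It meets `a ^ 3` when `m = 3`, and
    -- `4 ≤ m` separates them.
    ∷ (λ ()) ∷ (λ ()) ∷ (λ ()) ∷ apart 3≋̸m ∷ [])
    where
    8≤N : 8 ℕ.≤ N
    8≤N = ℕ.*-monoʳ-≤ 2 4≤m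
    -- For literal arguments the implicit bounds evaluate to the unit type and are filled in
    -- automatically.
    small : ∀ i j → {T (i ℕ.<ᵇ 8)} → {T (j ℕ.<ᵇ 8)} → i ≢ j → ¬ i ≋ j
    small i j {i<8} {j<8} = ≢⇒≋̸ (ℕ.<-≤-trans (ℕ.<ᵇ⇒< i 8 i<8) 8≤N) (ℕ.<-≤-trans (ℕ.<ᵇ⇒< j 8 j<8) 8≤N)
    3≋̸0 = small 3 0 λ ()
    3≋̸1 = small 3 1 λ ()
    3≋̸2 = small 3 2 λ ()
    4≋̸0 = small 4 0 λ ()
    4≋̸1 = small 4 1 λ ()
    5≋̸0 = small 5 0 λ ()
    3≋̸m : ¬ 3 ≋ (m ℕ.+ 0)
    3≋̸m = ≢⇒≋̸ 4≤N m+0<N (ℕ.<⇒≢ (ℕ.≤-trans 4≤m (ℕ.m≤m+n m 0)))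

  module _ {d : Word Generator → Word Generator → ℕ} (isDistance : IsDistance d) where

    open Digraph.Distance (QuaternionCayley m 2≤m) isDistance using (geodesic-split)

    legs-b : ∀ i → let p = sources-b i; q = targets-b i in
             d p q ≡ 1 × d ε p ℕ.+ d p q ≡ d ε q
    legs-b 0F = geodesic-split (stop refl) ε→b (far-from-ε 1 ((λ ()) ∷ []))
    legs-b 1F = geodesic-split ε→a (a ∙b) (far-from-ε 2
      ((λ ()) ∷ (λ ()) ∷ (λ ()) ∷ apart 1≢0 ∷ []))
    legs-b 2F = geodesic-split ε→a⁻¹ ((a ⁻¹) ∙b) (far-from-ε 2
      ((λ ()) ∷ (λ ()) ∷ (λ ()) ∷ apart (1≢0 ∘ ≋-unpred 0 ∘ ≡.sym) ∷ []))
    -- The target is `a ^ m`. It avoids `a` since `m` is not 1, and `a ⁻¹` since `suc m < N`; both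
    -- facts rest on `2 ≤ m`.
    legs-b 3F = geodesic-split ε→b (b ∙b) (far-from-ε 2
      ( apart (≋̸0 m+0<N)
      ∷ apart (≢⇒≋̸ m+0<N (ℕ.≤-trans (s≤s (s≤s z≤n)) 4≤N) (ℕ.<⇒≢ 2≤m ∘ ≡.sym ∘ ≡.trans (≡.sym (ℕ.+-identityʳ m))))
      ∷ apart (≋̸0 1+m+0<N ∘ ≋-unpred 0)
      ∷ (λ ()) ∷ []))

    -- Only the last leg depends on the size of `m`, so its walk and lower bound are arguments. It
    -- starts at the base vertex `a ⁻¹` itself, and legs 1 and 2 are the resting masses.
    legs-a : ∀ D → Walk (a ⁻¹) (a ∙ a) D → (∀ j → Walk (a ⁻¹) (a ∙ a) j → D ℕ.≤ j) →
             ∀ i → let p = sources-a i; q = targets-a i in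
             d p q ≡ Vec.lookup (1 ∷ 0 ∷ 0 ∷ 1 ∷ D ∷ []) i × d (a ⁻¹) p ℕ.+ d p q ≡ d (a ⁻¹) q
    legs-a D walk ≤D = λ where
        0F → geodesic-split a⁻¹→ε ε→a far-a
        1F → geodesic-split a⁻¹→ε (stop refl) (far-from-a⁻¹ 1 (apart 1≢0 ∷ []))
        2F → geodesic-split (a⁻¹→ε ++ʷ ε→a) (stop refl) far-a
        -- The arc from `b` labelled `a ⁻¹` ends at `a ∙ b`.
        3F → geodesic-split (a⁻¹→ε ++ʷ ε→b) (b ∙a⁻¹ ++ʷ stop (≈-complete _ _ ∼-refl)) far-ab
        4F → geodesic-split (stop refl) walk ≤D
      where
      far-a : ∀ j → Walk (a ⁻¹) a j → 2 ℕ.≤ j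
      far-a = far-from-a⁻¹ 2 (apart 2≋̸0 ∷ apart 2≋̸1 ∷ apart 2≋̸-1 ∷ (λ ()) ∷ [])
      far-ab : ∀ j → Walk (a ⁻¹) (a ∙ b) j → 3 ℕ.≤ j
      -- The translated target is `a ^ 2 ∙ b`; its flag leaves only the states with exponents 1, -1,
      -- 0, -1, 1 to be excluded by arithmetic.
      far-ab = far-from-a⁻¹ 3
        ( (λ ())
        ∷ (λ ()) ∷ (λ ()) ∷ (λ ()) ∷ apart 2≋̸1
        ∷ (λ ()) ∷ (λ ()) ∷ (λ ()) ∷ apart 2≋̸-1
        ∷ apart 2≋̸0 ∷ apart 2≋̸-1 ∷ apart 2≋̸1 ∷ (λ ()) ∷ [])

  module _ {c ℓ₁ ℓ₂} (R : RealField c ℓ₁ ℓ₂) where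

    open Curvature R (QuaternionCayley m 2≤m) using (HasRicciCurvature)
    open Transport R (QuaternionCayley m 2≤m) using (curvature-perfect-matching; curvature-mutual-arcs)
    private
      module ℝ = Reals R
      isDistance = proj₂ (shortest-walks connected)

    curvature-b : HasRicciCurvature ε b ℝ.0#
    curvature-b = curvature-perfect-matching isDistance ε ε-hood b-hood (legs-b isDistance)

    curvature-a : ∀ D j κ → D ℕ.+ j ≡ 3 → κ ℝ.* ℝ.fromℕ 3 ℝ.≈ ℝ.fromℕ j → Walk (a ⁻¹) (a ∙ a) D →
                  (∀ i → Walk (a ⁻¹) (a ∙ a) i → D ℕ.≤ i) → HasRicciCurvature ε a κ
    curvature-a D j κ D+j≡3 κ*3≈j walk ≤D =
      curvature-mutual-arcs isDistance (a ⁻¹) D j κ ε-hood a-hood (legs-a isDistance D walk ≤D) D+j≡3 κ*3≈j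

-- The curvature values in the separate ranges of `m`.

open import Data.Nat.Base using (_≤_)
open RealField using (0#; fromℕ; _/ℕ_)
open Curvature using (HasRicciCurvature)

proposition4p3 : ∀ {c ℓ₁ ℓ₂} (R : RealField c ℓ₁ ℓ₂) (m : ℕ) (2≤m : 2 ≤ m) →
    (m ≡ 2 → HasRicciCurvature R (QuaternionCayley m 2≤m) ε a (_/ℕ_ R (fromℕ R 2) 3))
    × (m ≡ 3 → HasRicciCurvature R (QuaternionCayley m 2≤m) ε a (_/ℕ_ R (fromℕ R 1) 3))
    × (4 ≤ m → HasRicciCurvature R (QuaternionCayley m 2≤m) ε a (0# R))
    × HasRicciCurvature R (QuaternionCayley m 2≤m) ε b (0# R)
proposition4p3 R (suc k) 2≤m =
    (λ { ≡.refl → curvature-a R 1 2 _ ≡.refl (/ℕ-* (fromℕ R 2) 3)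
           -- For `m = 2`, `a ^ 4 ≈ ε` makes two arcs labelled `a ⁻¹` and `a` lead to the same
           -- element: `a ⁻¹ ∙ a ⁻¹ ≈ a ∙ a`. With `m` a numeral the residues are compared by
           -- evaluation.
           ((a ⁻¹) ∙a⁻¹ ++ʷ stop (≈-complete (a ⁻¹ ∙ a ⁻¹) (a ∙ a) (≡.refl , Bool.false)))
           far-a²₁ })
  , (λ { ≡.refl → curvature-a R 2 1 _ ≡.refl (/ℕ-* (fromℕ R 1) 3)
           -- For `m = 3`, `b ∙ b ≈ a ^ 3`, so two arcs labelled `b` replace three labelled `a`.
           ((a ⁻¹) ∙b ++ʷ (a ⁻¹ ∙ b) ∙b ++ʷ stop (≈-complete (a ⁻¹ ∙ b ∙ b) (a ∙ a) (≡.refl , Bool.false)))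
           (far-a²₂ ℕ.≤-refl) })
  , (λ 4≤m → curvature-a R 3 0 _ ≡.refl (zeroˡ (fromℕ R 3))
       (a⁻¹→ε ++ʷ ε→a ++ʷ a ∙a) (far-a²₃ 4≤m))
  , curvature-b R
  where
  open Quaternion k 2≤m
  open Digraph (QuaternionCayley (suc k) 2≤m) using (stop; _++ʷ_)
  open NormalForm k using (_,_)
  open Reals R using (/ℕ-*; zeroˡ)
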